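{- Let $\mathcal G$ be an $(n,c,k,\mu)$-admissible hypergraph. Then $\mathcal G$ has a spanning Euler tour if any of the following holds: (i) $\delta_2(\mathcal G)\geq k$; (ii) $\delta_3(\mathcal G)\geq 1$ and $n\geq k^2-3k+5$; (iii) $\delta_r(\mathcal G)\geq 1$ for some $r$ with $4\leq r\leq k$.
   Context: A hypergraph $\mathcal G=(V,E)$ has a finite vertex set $V$ and an edge multiset $E$ of subsets of $V$; $\mu(\mathcal G)$ is the maximum edge multiplicity, $\operatorname{rk}(\mathcal G)=\max_{e\in E}|e|$, $\operatorname{crk}(\mathcal G)=\min_{e\in E}|e|$. For $T\subseteq V$, $\deg(T)$ is the number of edges (with multiplicity) containing $T$, and $\delta_t(\mathcal G)=\min\{\deg(T):T\subseteq V,|T|=t\}$. An $n$-vertex hypergraph is $(n,c,k,\mu)$-admissible if $\operatorname{crk}(\mathcal G)=c\geq 3$, $\operatorname{rk}(\mathcal G)=k$, $\mu(\mathcal G)=\mu$ and $n\geq g(c,k,\mu)$, where $g(3,3,\mu)=7$, $g(3,4,\mu)=10$, $g(c,k,\mu)=\binom{k}{2}+1$ if $c\geq 4$ and $k\leq 2c-2$, $g(c,k,\mu)=(4c^2+k^2-3k+2)/(4c-2k+2)$ if $c\geq 3$ and $2c-1\leq k\leq 2c$, and $g(c,k,\mu)=2\mu(k-1)(2^{k-c-1}-2^c+1)+\binom{k}{2}+1$ if $k>2c$. A closed walk is a cyclic alternating sequence $v_1,e_1,\dots,v_t,e_t$ of vertices and edges with $\{v_i,v_{i+1}\}\subseteq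 e_i$, $v_i\ne v_{i+1}$ (indices mod $t$). An Euler tour is a closed walk traversing each edge of $\mathcal G$ exactly once (each edge of the multiset appears exactly once among the $e_i$); it is spanning if every vertex of $\mathcal G$ appears among the $v_i$. -}

module Defs where

open import Data.Nat using (ℕ; zero; suc; _+_; _*_; _∸_; _^_; _≤_; _<_; _<?_)
open import Data.Nat.Combinatorics using (_C_)
open import Data.Bool using (Bool)
import Data.Bool as Bool
open import Data.Fin using (Fin; toℕ; fromℕ<) renaming (zero to fzero)
open import Data.Fin.Subset using (Subset; _∈_; _⊆_; ∣_∣)
open import Data.Fin.Subset.Properties using (_⊆?_)
open import Data.List using (List; length; filter; allFin)
open import Data.Vec.Properties using (≡-dec)
open import Data.Product using (Σ; _×_; ∃; _,_)
open import Relation.Binary.PropositionalEquality using (_≡_; _≢_)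
open import Relation.Nullary using (yes; no)
open import Function.Definitions using (Bijective)

-- A hypergraph on vertex set Fin n with an edge multiset of size m,
-- given as an indexed family of edges (repeated subsets = multiplicity).
Hypergraph : ℕ → ℕ → Set
Hypergraph n m = Fin m → Subset n

mult : ∀ {n m} → Hypergraph n m → Fin m → ℕ
mult {n} {m} E i = length (filter (λ j → ≡-dec Bool._≟_ (E j) (E i)) (allFin m))

deg : ∀ {n m} → Hypergraph n m → Subset n → ℕ
deg {n} {m} E T = length (filter (λ j → T ⊆? E j) (allFin m))

HasRank : ∀ {n m} → Hypergraph n m → ℕ → Set
HasRank E k = (∀ i → ∣ E i ∣ ≤ k) × ∃ λ i → ∣ E i ∣ ≡ k

HasCorank : ∀ {n m} → Hypergraph n m → ℕ → Set
HasCorank E c = (∀ i → c ≤ ∣ E i ∣) × ∃ λ i → ∣ E i ∣ ≡ c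

HasMaxMult : ∀ {n m} → Hypergraph n m → ℕ → Set
HasMaxMult E μ = (∀ i → mult E i ≤ μ) × ∃ λ i → mult E i ≡ μ

MinDegGE : ∀ {n m} → Hypergraph n m → ℕ → ℕ → Set
MinDegGE {n} E t d = (T : Subset n) → ∣ T ∣ ≡ t → d ≤ deg E T

-- n ≥ g(c,k,μ), written case by case as in the paper.
-- In the rational case, n ≥ (4c²+k²-3k+2)/(4c-2k+2) is stated multiplied
-- out by the positive denominator, and k²-3k+2 = (k-1)(k-2).
AboveG : ℕ → ℕ → ℕ → ℕ → Set
AboveG n c k μ =
    (c ≡ 3 → k ≡ 3 → 7 ≤ n)
  × (c ≡ 3 → k ≡ 4 → 10 ≤ n)
  × (4 ≤ c → k ≤ 2 * c ∸ 2 → (k C 2) + 1 ≤ n)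
  × (3 ≤ c → 2 * c ∸ 1 ≤ k → k ≤ 2 * c →
       4 * c * c + (k ∸ 1) * (k ∸ 2) ≤ n * (4 * c + 2 ∸ 2 * k))
  × (3 ≤ c → 2 * c < k →
       2 * μ * (k ∸ 1) * (2 ^ (k ∸ c ∸ 1) + 1 ∸ 2 ^ c) + (k C 2) + 1 ≤ n)

Admissible : ∀ {n m} → Hypergraph n m → ℕ → ℕ → ℕ → Set
Admissible {n} E c k μ =
  HasCorank E c × 3 ≤ c × HasRank E k × HasMaxMult E μ × AboveG n c k μ

next : ∀ {m} → Fin m → Fin m
next {suc m} i with suc (toℕ i) <? suc m
... | yes p = fromℕ< p
... | no _  = fzero

record EulerTour {n m : ℕ} (E : Hypergraph n m) : Set where
  field
    vert     : Fin m → Fin n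
    edge     : Fin m → Fin m
    edge-bij : Bijective _≡_ _≡_ edge
    inc₁     : ∀ i → vert i ∈ E (edge i)
    inc₂     : ∀ i → vert (next i) ∈ E (edge i)
    distinct : ∀ i → vert i ≢ vert (next i)

Spanning : ∀ {n m} {E : Hypergraph n m} → EulerTour E → Set
Spanning {n} {m} τ = (v : Fin n) → ∃ λ i → EulerTour.vert τ i ≡ v

HasSpanningEulerTour : ∀ {n m} → Hypergraph n m → Set
HasSpanningEulerTour E = Σ (EulerTour E) Spanning

module Submission where

-- An Euler tour amounts to a choice of two distinct vertices ("link") in every
-- edge such that the links form a connected even graph on all vertices.
--
-- Each of (ii) and (iii) implies (i) by counting extensions of a vertex set.  An
-- even choice exists: since every pair has degree ≥ k, each new vertex v lies in an
-- unused edge e with some earlier vertex u, and if z is a third vertex of e, then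
-- switching e between the links zv and zu corrects the parity of v.
--
-- Now let W be a closed trail through a proper vertex subset S, with the other
-- links even and disjoint from S.  For u ∈ S and v ∉ S consider the edges through
-- u and v whose link contains u or v.  If e contains a vertices of S and b other
-- vertices, it has ab crossing pairs and is counted for 2b of them if its link
-- lies in S, and for 2a otherwise, so for at least 2ab/(k-1).  As every pair has
-- degree ≥ k, some crossing pair (u, v) is counted at least three times, so W leaves
-- u twice along such edges, or enters u twice, or there are two such links vx, vy
-- outside W, or one link ux in W and one link vy outside.  Two links ux, uy both
-- leaving (or both entering) u in W become vx, vy, and W closes up after reversing a
-- segment; vx, vy outside W become ux, uy, and a closed trail through u is absorbed;
-- ux in W and vy outside become vx, uy, and a trail from y to v is spliced into W.

open import Defs
open import Data.Nat hiding (_≟_; parity)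
open import Data.Nat.Properties hiding (_≟_)
open import Data.Nat.Combinatorics using (_C_; nC1≡n; nCk+nC[k+1]≡[n+1]C[k+1])
open import Data.Nat.ListAction using (sum)
open import Data.Nat.ListAction.Properties using (sum-++; sum-↭)
open import Data.Nat.Solver using (module +-*-Solver)
open import Data.Bool using (Bool; true; false; _xor_; if_then_else_)
open import Data.Bool.Properties using (xor-comm; xor-assoc; xor-same; xor-identityʳ)
open import Data.Empty using (⊥)
open import Data.Fin using (Fin; toℕ; cast) renaming (zero to fzero; suc to fsuc)
open import Data.Fin.Properties using (_≟_; all?; ¬∀⟶∃¬; toℕ-fromℕ<; toℕ-cast; toℕ<n; toℕ-injective)
open import Data.Fin.Subset using (Subset; ∣_∣; ⁅_⁆; _∪_) renaming (_∈_ to _∈ₛ_)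
open import Data.Fin.Subset.Properties
  using (_∈?_; _⊆?_; x∈p∪q⁻; x∈p∪q⁺; x∈⁅y⁆⇒x≡y; x∈⁅x⁆; ∣⁅x⁆∣≡1; ∣p∣≤n)
open import Data.List
  using (List; []; _∷_; [_]; _++_; map; length; lookup; filter; allFin; tabulate; cartesianProduct)
open import Data.List.Properties
  using (map-++; map-cong; map-∘; map-tabulate; length-map; length-++; length-tabulate; ++-assoc; ++-identityʳ)
open import Data.List.Membership.Propositional using (_∈_; _∉_; find)
open import Data.List.Membership.Propositional.Properties
  using (∈-∃++; ∈-allFin; ∈-++⁺ʳ; ∈-tabulate⁺; ∈-map⁺; ∈-map⁻; ∈-lookup)
open import Data.List.Relation.Binary.Permutation.Propositional
  using (_↭_; refl; prep; swap; trans; ↭-refl; ↭-reflexive; ↭-sym; ↭-trans; ↭⇒↭ₛ)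
open import Data.List.Relation.Binary.Permutation.Propositional.Properties as ↭ₚ
  using (map⁺; ↭-length; shift; ∈-resp-↭; ++-commutativeMonoid)
import Data.List.Relation.Binary.Permutation.Setoid.Properties as ↭ₛ
open import Data.List.Relation.Unary.All as All using (All; []; _∷_)
open import Data.List.Relation.Unary.AllPairs using ([]; _∷_)
open import Data.List.Relation.Unary.Any as Any using (Any; here; there; any?)
open import Data.List.Relation.Unary.Any.Properties using (++⁺ˡ; ++⁺ʳ; ++⁻; lookup-index)
open import Data.List.Relation.Unary.Unique.Propositional using (Unique)
open import Data.List.Relation.Unary.Unique.Propositional.Properties using (allFin⁺)
open import Data.Product using (∃; ∃₂; _×_; _,_; proj₁; proj₂)
open import Data.Sum using (_⊎_; inj₁; inj₂) renaming (swap to swap⊎)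
open import Data.Vec using ([]; _∷_)
open import Function using (_∘_; id)
open import Relation.Binary.PropositionalEquality as ≡
  using (_≡_; _≢_; refl; cong; cong₂; subst; subst₂; sym)
open import Relation.Nullary using (Dec; yes; no; ¬_; contradiction; does)
open import Relation.Nullary.Decidable using (¬?; _⊎-dec_)

-- Finite sums over lists and averaging arguments.

∑ : {A : Set} → List A → (A → ℕ) → ℕ
∑ xs f = sum (map f xs)

∑-mono : {A : Set} (xs : List A) {f g : A → ℕ} → (∀ {x} → x ∈ xs → f x ≤ g x) → ∑ xs f ≤ ∑ xs g
∑-mono []       f≤g = z≤n
∑-mono (x ∷ xs) f≤g = +-mono-≤ (f≤g (here refl)) (∑-mono xs (f≤g ∘ there))

∑-cong : {A : Set} (xs : List A) {f g : A → ℕ} → (∀ x → f x ≡ g x) → ∑ xs f ≡ ∑ xs g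
∑-cong xs f≡g = cong sum (map-cong f≡g xs)

∑-+ : {A : Set} (xs : List A) (f g : A → ℕ) → ∑ xs (λ x → f x + g x) ≡ ∑ xs f + ∑ xs g
∑-+ []       f g = refl
∑-+ (x ∷ xs) f g = begin
  f x + g x + ∑ xs (λ y → f y + g y) ≡⟨ cong (f x + g x +_) (∑-+ xs f g) ⟩
  f x + g x + (∑ xs f + ∑ xs g)      ≡⟨ +-assoc (f x) (g x) _ ⟩
  f x + (g x + (∑ xs f + ∑ xs g))    ≡⟨ cong (f x +_) (+-assoc (g x) _ _) ⟨
  f x + (g x + ∑ xs f + ∑ xs g)      ≡⟨ cong (λ t → f x + (t + ∑ xs g)) (+-comm (g x) _) ⟩
  f x + (∑ xs f + g x + ∑ xs g)      ≡⟨ cong (f x +_) (+-assoc (∑ xs f) _ _) ⟩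
  f x + (∑ xs f + (g x + ∑ xs g))    ≡⟨ +-assoc (f x) _ _ ⟨
  f x + ∑ xs f + (g x + ∑ xs g)      ∎
  where open ≡.≡-Reasoning

∑-*ˡ : {A : Set} (xs : List A) (c : ℕ) (f : A → ℕ) → ∑ xs (λ x → c * f x) ≡ c * ∑ xs f
∑-*ˡ []       c f = sym (*-zeroʳ c)
∑-*ˡ (x ∷ xs) c f = ≡.trans (cong (c * f x +_) (∑-*ˡ xs c f)) (sym (*-distribˡ-+ c (f x) _))

∑-*ʳ : {A : Set} (xs : List A) (c : ℕ) (f : A → ℕ) → ∑ xs (λ x → f x * c) ≡ ∑ xs f * c
∑-*ʳ xs c f = ≡.trans (∑-cong xs (λ x → *-comm (f x) c)) (≡.trans (∑-*ˡ xs c f) (*-comm c _))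

∑-const : {A : Set} (xs : List A) (c : ℕ) → ∑ xs (λ _ → c) ≡ length xs * c
∑-const []       c = refl
∑-const (x ∷ xs) c = cong (c +_) (∑-const xs c)

∑-zero : {A : Set} (xs : List A) → ∑ xs (λ _ → 0) ≡ 0
∑-zero xs = ≡.trans (∑-const xs 0) (*-zeroʳ (length xs))

∑-comm : {A B : Set} (xs : List A) (ys : List B) (f : A → B → ℕ) →
  ∑ xs (λ x → ∑ ys (f x)) ≡ ∑ ys (λ y → ∑ xs (λ x → f x y))
∑-comm []       ys f = sym (∑-zero ys)
∑-comm (x ∷ xs) ys f = ≡.trans (cong (∑ ys (f x) +_) (∑-comm xs ys f)) (sym (∑-+ ys (f x) _))

∑-++ : {A : Set} (xs ys : List A) (f : A → ℕ) → ∑ (xs ++ ys) f ≡ ∑ xs f + ∑ ys f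
∑-++ xs ys f = ≡.trans (cong sum (map-++ f xs ys)) (sum-++ (map f xs) (map f ys))

∑-map : {A B : Set} (h : A → B) (xs : List A) (f : B → ℕ) → ∑ (map h xs) f ≡ ∑ xs (f ∘ h)
∑-map h xs f = cong sum (sym (map-∘ xs))

∑-↭ : {A : Set} {xs ys : List A} (f : A → ℕ) → xs ↭ ys → ∑ xs f ≡ ∑ ys f
∑-↭ f p = sum-↭ (map⁺ f p)

∑-× : {A B : Set} (xs : List A) (ys : List B) (f : A → ℕ) (g : B → ℕ) →
  ∑ (cartesianProduct xs ys) (λ (x , y) → f x * g y) ≡ ∑ xs f * ∑ ys g
∑-× []       ys f g = refl
∑-× (x ∷ xs) ys f g = begin
  ∑ (map (x ,_) ys ++ cartesianProduct xs ys) h     ≡⟨ ∑-++ (map (x ,_) ys) _ h ⟩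
  ∑ (map (x ,_) ys) h + ∑ (cartesianProduct xs ys) h
    ≡⟨ cong₂ _+_ (≡.trans (∑-map (x ,_) ys h) (∑-*ˡ ys (f x) g)) (∑-× xs ys f g) ⟩
  f x * ∑ ys g + ∑ xs f * ∑ ys g                    ≡⟨ *-distribʳ-+ (∑ ys g) (f x) _ ⟨
  (f x + ∑ xs f) * ∑ ys g                           ∎
  where
  open ≡.≡-Reasoning
  h = λ (x , y) → f x * g y

∑-<⇒∃ : {A : Set} (xs : List A) {f g : A → ℕ} → ∑ xs f < ∑ xs g → ∃ λ x → x ∈ xs × f x < g x
∑-<⇒∃ []       ()
∑-<⇒∃ (x ∷ xs) {f} {g} lt with f x <? g x
... | yes p = x , here refl , p
... | no ¬p with ∑-<⇒∃ xs (+-cancelˡ-< (f x) _ _ (<-≤-trans lt (+-monoˡ-≤ _ (≮⇒≥ ¬p))))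
...   | y , y∈ , q = y , there y∈ , q

∑-mono-< : {A : Set} (xs : List A) {f g : A → ℕ} {x : A} → (∀ y → f y ≤ g y) → x ∈ xs → f x < g x →
  ∑ xs f < ∑ xs g
∑-mono-< (x ∷ xs) f≤g (here refl) lt = +-mono-<-≤ lt (∑-mono xs (λ {y} _ → f≤g y))
∑-mono-< (x ∷ xs) f≤g (there x∈) lt  = +-mono-≤-< (f≤g x) (∑-mono-< xs f≤g x∈ lt)

∑-pos⇒∃ : {A : Set} (xs : List A) {f : A → ℕ} → 0 < ∑ xs f → ∃ λ x → x ∈ xs × 0 < f x
∑-pos⇒∃ xs {f} lt = ∑-<⇒∃ xs {λ _ → 0} {f} (subst (_< ∑ xs f) (sym (∑-zero xs)) lt)

-- With terms at most 1, a sum of 2 needs two different positions. The list is returned cut at both,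
-- the form in which a trail is reassembled later.
∑-≥2⇒split : {A : Set} (xs : List A) {f : A → ℕ} → (∀ {x} → x ∈ xs → f x ≤ 1) → 2 ≤ ∑ xs f →
  ∃₂ λ as x → ∃₂ λ bs y → ∃ λ cs → xs ≡ as ++ x ∷ bs ++ y ∷ cs × 0 < f x × 0 < f y
∑-≥2⇒split []       f≤1 ()
∑-≥2⇒split (x ∷ xs) {f} f≤1 le with f x in eq | f≤1 (here refl)
... | zero  | _ with ∑-≥2⇒split xs (f≤1 ∘ there) le
...   | as , y , bs , z , cs , refl , p , q = x ∷ as , y , bs , z , cs , refl , p , q
∑-≥2⇒split (x ∷ xs) {f} f≤1 (s≤s le) | suc zero | _ with ∑-pos⇒∃ xs le
... | y , y∈ , q with ∈-∃++ y∈
...   | bs , cs , refl = [] , x , bs , y , cs , refl , ≤-reflexive (sym eq) , q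
∑-≥2⇒split (x ∷ xs) {f} f≤1 le | suc (suc _) | s≤s ()

-- Indicators and the counting of finite sets.

𝟙 : {P : Set} → Dec P → ℕ
𝟙 d = if does d then 1 else 0

𝟙-≤1 : {P : Set} (d : Dec P) → 𝟙 d ≤ 1
𝟙-≤1 (yes _) = ≤-refl
𝟙-≤1 (no _)  = z≤n

𝟙-pos⇒ : {P : Set} (d : Dec P) → 0 < 𝟙 d → P
𝟙-pos⇒ (yes p) _ = p

𝟙-yes : {P : Set} (d : Dec P) → P → 𝟙 d ≡ 1
𝟙-yes (yes _) _ = refl
𝟙-yes (no ¬p) p = contradiction p ¬p

𝟙-no : {P : Set} (d : Dec P) → ¬ P → 𝟙 d ≡ 0
𝟙-no (yes p) ¬p = contradiction p ¬p
𝟙-no (no _)  _  = refl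

𝟙-mono : {P Q : Set} (d : Dec P) (d′ : Dec Q) → (P → Q) → 𝟙 d ≤ 𝟙 d′
𝟙-mono (yes p) (yes _) f = ≤-refl
𝟙-mono (yes p) (no ¬q) f = contradiction (f p) ¬q
𝟙-mono (no _)  _       f = z≤n

∑-filter : {A : Set} {P : A → Set} (P? : ∀ x → Dec (P x)) (xs : List A) →
  length (filter P? xs) ≡ ∑ xs (λ x → 𝟙 (P? x))
∑-filter P? []       = refl
∑-filter P? (x ∷ xs) with P? x
... | yes _ = cong suc (∑-filter P? xs)
... | no _  = ∑-filter P? xs

∑-allFin-suc : ∀ {n} (f : Fin (suc n) → ℕ) → ∑ (allFin (suc n)) f ≡ f fzero + ∑ (allFin n) (f ∘ fsuc)
∑-allFin-suc {n} f = cong (λ l → f fzero + l) (cong sum (≡.trans (map-tabulate fsuc f) (sym (map-tabulate id (f ∘ fsuc)))))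

∑-δ : ∀ {n} (a : Fin n) (f : Fin n → ℕ) → ∑ (allFin n) (λ x → 𝟙 (a ≟ x) * f x) ≡ f a
∑-δ {suc n} fzero    f = begin
  ∑ (allFin (suc n)) (λ x → 𝟙 (fzero ≟ x) * f x) ≡⟨ ∑-allFin-suc (λ x → 𝟙 (fzero ≟ x) * f x) ⟩
  f fzero + 0 + ∑ (allFin n) (λ _ → 0)           ≡⟨ cong₂ _+_ (+-identityʳ _) (∑-zero (allFin n)) ⟩
  f fzero + 0                                    ≡⟨ +-identityʳ _ ⟩
  f fzero                                        ∎
  where open ≡.≡-Reasoning
∑-δ {suc n} (fsuc a) f = begin
  ∑ (allFin (suc n)) (λ x → 𝟙 (fsuc a ≟ x) * f x)   ≡⟨ ∑-allFin-suc (λ x → 𝟙 (fsuc a ≟ x) * f x) ⟩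
  ∑ (allFin n) (λ x → 𝟙 (fsuc a ≟ fsuc x) * f (fsuc x)) ≡⟨ ∑-cong (allFin n) (λ x → cong (_* f (fsuc x)) (step x)) ⟩
  ∑ (allFin n) (λ x → 𝟙 (a ≟ x) * f (fsuc x))       ≡⟨ ∑-δ a (f ∘ fsuc) ⟩
  f (fsuc a)                                        ∎
  where
  open ≡.≡-Reasoning
  step : ∀ x → 𝟙 (fsuc a ≟ fsuc x) ≡ 𝟙 (a ≟ x)
  step x with a ≟ x
  ... | yes _ = refl
  ... | no _  = refl

∑-δ₁ : ∀ {n} (a : Fin n) → ∑ (allFin n) (λ x → 𝟙 (a ≟ x)) ≡ 1
∑-δ₁ {n} a = ≡.trans (∑-cong (allFin n) (λ x → sym (*-identityʳ _))) (∑-δ a (λ _ → 1))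

∑-∈ : ∀ {n} (p : Subset n) → ∑ (allFin n) (λ v → 𝟙 (v ∈? p)) ≡ ∣ p ∣
∑-∈ []          = refl
∑-∈ {suc n} (b ∷ p) = ≡.trans (∑-allFin-suc (λ v → 𝟙 (v ∈? (b ∷ p)))) (go b)
  where
  tail : ∀ b → ∑ (allFin n) (λ v → 𝟙 (fsuc v ∈? (b ∷ p))) ≡ ∣ p ∣
  tail b = ≡.trans (∑-cong (allFin n) step) (∑-∈ p)
    where
    step : ∀ v → 𝟙 (fsuc v ∈? (b ∷ p)) ≡ 𝟙 (v ∈? p)
    step v with v ∈? p
    ... | yes _ = refl
    ... | no _  = refl
  go : ∀ b → 𝟙 (fzero ∈? (b ∷ p)) + ∑ (allFin n) (λ v → 𝟙 (fsuc v ∈? (b ∷ p))) ≡ ∣ b ∷ p ∣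
  go true  = cong suc (tail true)
  go false = tail false

-- The indicators of `u` and `v` have total 2, so at some `z` the indicator of `p` exceeds their
-- sum, which must be 0 there. The case of equal `u` and `v` is included.
third∈ : ∀ {n} (p : Subset n) → 3 ≤ ∣ p ∣ → (u v : Fin n) → ∃ λ z → z ∈ₛ p × u ≢ z × v ≢ z
third∈ {n} p 3≤p u v = z , 𝟙-pos⇒ (z ∈? p) (≤-<-trans z≤n z-extra) , ne u (m≤m+n _ _) , ne v (m≤n+m _ _)
  where
  total : ∑ (allFin n) (λ x → 𝟙 (u ≟ x) + 𝟙 (v ≟ x)) ≡ 2
  total = ≡.trans (∑-+ (allFin n) (λ x → 𝟙 (u ≟ x)) (λ x → 𝟙 (v ≟ x))) (cong₂ _+_ (∑-δ₁ u) (∑-δ₁ v))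
  found = ∑-<⇒∃ (allFin n) {λ x → 𝟙 (u ≟ x) + 𝟙 (v ≟ x)} {λ x → 𝟙 (x ∈? p)}
            (subst₂ _<_ (sym total) (sym (∑-∈ p)) 3≤p)
  z = proj₁ found
  z-extra = proj₂ (proj₂ found)
  ne : ∀ w → 𝟙 (w ≟ z) ≤ 𝟙 (u ≟ z) + 𝟙 (v ≟ z) → w ≢ z
  ne w le w≡z = <⇒≱ (<-≤-trans z-extra (𝟙-≤1 (z ∈? p))) (≤-trans (≤-reflexive (sym (𝟙-yes (w ≟ z) w≡z))) le)

-- Links, trails and parities, with booleans under `_xor_` as integers modulo 2.

δ : ∀ {n} → Fin n → Fin n → Bool
δ a x = does (a ≟ x)

δ-refl : ∀ {n} (a : Fin n) → δ a a ≡ true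
δ-refl a with a ≟ a
... | yes _  = refl
... | no a≢a = contradiction refl a≢a

δ-≢ : ∀ {n} {a b : Fin n} → a ≢ b → δ a b ≡ false
δ-≢ {a = a} {b} a≢b with a ≟ b
... | yes a≡b = contradiction a≡b a≢b
... | no _    = refl

module Trails {n m : ℕ} (E : Hypergraph n m) where

  -- The orientation is the direction in which a trail runs through the edge; parities ignore it.
  -- Edges enter by index, so parallel edges stay distinct.
  record Link : Set where
    field
      edge    : Fin m
      src tgt : Fin n
      src∈    : src ∈ₛ E edge
      tgt∈    : tgt ∈ₛ E edge
      src≢tgt : src ≢ tgt

  open Link public

  flip : Link → Link
  flip l = record
    { edge = edge l ; src = tgt l ; tgt = src l ; src∈ = tgt∈ l ; tgt∈ = src∈ l ; src≢tgt = src≢tgt l ∘ sym }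

  Chain : Fin n → List Link → Fin n → Set
  Chain x []       y = x ≡ y
  Chain x (l ∷ ls) y = src l ≡ x × Chain (tgt l) ls y

  chain-++ : ∀ {x y z} xs {ys} → Chain x xs y → Chain y ys z → Chain x (xs ++ ys) z
  chain-++ []       refl    d = d
  chain-++ (l ∷ xs) (p , c) d = p , chain-++ xs c d

  chain-split : ∀ {x z} xs {ys} → Chain x (xs ++ ys) z → ∃ λ y → Chain x xs y × Chain y ys z
  chain-split []       c       = _ , refl , c
  chain-split (l ∷ xs) (p , c) with chain-split xs c
  ... | y , d , d′ = y , (p , d) , d′

  reversed : List Link → List Link
  reversed []       = []
  reversed (l ∷ ls) = reversed ls ++ [ flip l ]

  reversed-++ : ∀ xs ys → reversed (xs ++ ys) ≡ reversed ys ++ reversed xs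
  reversed-++ []       ys = sym (++-identityʳ _)
  reversed-++ (x ∷ xs) ys =
    ≡.trans (cong (_++ [ flip x ]) (reversed-++ xs ys)) (++-assoc (reversed ys) (reversed xs) _)

  chain-reversed : ∀ {x y} ls → Chain x ls y → Chain y (reversed ls) x
  chain-reversed []       c          = sym c
  chain-reversed (l ∷ ls) (refl , c) = chain-++ (reversed ls) (chain-reversed ls c) (refl , refl)

  infix 3 _≈ₑ_
  -- Only the edges are compared, since surgeries choose new ends for a link but must keep using
  -- every edge once.
  _≈ₑ_ : List Link → List Link → Set
  xs ≈ₑ ys = map edge xs ↭ map edge ys

  ++-congʳ : ∀ zs {xs ys} → xs ≈ₑ ys → zs ++ xs ≈ₑ zs ++ ys
  ++-congʳ []       p = p
  ++-congʳ (z ∷ zs) p = prep _ (++-congʳ zs p)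

  ++-congˡ : ∀ {xs ys} zs → xs ≈ₑ ys → xs ++ zs ≈ₑ ys ++ zs
  ++-congˡ {xs} {ys} zs p rewrite map-++ edge xs zs | map-++ edge ys zs =
    ↭ₚ.++⁺ʳ _ p

  reversed-≈ₑ : ∀ ls → reversed ls ≈ₑ ls
  reversed-≈ₑ []       = ↭-refl
  reversed-≈ₑ (l ∷ ls) =
    ↭-trans (map⁺ edge (shift (flip l) (reversed ls) []))
      (prep _ (subst (λ zs → map edge zs ↭ map edge ls)
        (sym (++-identityʳ _)) (reversed-≈ₑ ls)))

  linkParity : Link → Fin n → Bool
  linkParity l x = δ (src l) x xor δ (tgt l) x

  parity : List Link → Fin n → Bool
  parity []       x = false
  parity (l ∷ ls) x = linkParity l x xor parity ls x

  parity-++ : ∀ xs ys x → parity (xs ++ ys) x ≡ parity xs x xor parity ys x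
  parity-++ []       ys x = refl
  parity-++ (l ∷ xs) ys x =
    ≡.trans (cong (linkParity l x xor_) (parity-++ xs ys x)) (sym (xor-assoc (linkParity l x) _ _))

  parity-↭ : ∀ {xs ys} → xs ↭ ys → ∀ x → parity xs x ≡ parity ys x
  parity-↭ refl         x = refl
  parity-↭ (prep l p)   x = cong (linkParity l x xor_) (parity-↭ p x)
  parity-↭ (swap k l p) x =
    ≡.trans (cong (λ b → linkParity k x xor (linkParity l x xor b)) (parity-↭ p x))
      (xor-swap (linkParity k x) (linkParity l x) _)
    where
    xor-swap : ∀ a b c → a xor (b xor c) ≡ b xor (a xor c)
    xor-swap false b     c = refl
    xor-swap true  false c = refl
    xor-swap true  true  c = refl
  parity-↭ (trans p q)  x = ≡.trans (parity-↭ p x) (parity-↭ q x)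

  Even : List Link → Set
  Even ls = ∀ x → parity ls x ≡ false

  -- Weaker than a permutation: links may be reversed, or several ends changed at once, as long as
  -- edges and parities survive. Extracting a trail from an even family needs just these two data.
  record _∼_ (xs ys : List Link) : Set where
    constructor mk∼
    field
      edges    : xs ≈ₑ ys
      parities : ∀ x → parity xs x ≡ parity ys x

  Touches : Fin n → Link → Set
  Touches x l = src l ≡ x ⊎ tgt l ≡ x

  touches? : ∀ x l → Dec (Touches x l)
  touches? x l = (src l ≟ x) ⊎-dec (tgt l ≟ x)

  orient : ∀ {x} l → Touches x l → ∃ λ l′ → src l′ ≡ x × edge l′ ≡ edge l ×
    (∀ y → linkParity l y ≡ linkParity l′ y) × (∀ {y} → Touches y l′ → Touches y l)
  orient l (inj₁ p) = l , p , refl , (λ _ → refl) , λ t → t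
  orient l (inj₂ p) = flip l , p , refl , (λ y → xor-comm (δ (src l) y) (δ (tgt l) y)) , swap⊎

  pull : ∀ {x l ls} → l ∈ ls → Touches x l →
    ∃₂ λ l′ ls′ → src l′ ≡ x × edge l′ ≡ edge l × ls ∼ (l′ ∷ ls′) × (∀ {y} → Touches y l′ → Touches y l)
  pull {x} {l} l∈ t with ∈-∃++ l∈ | orient l t
  ... | as , bs , refl | l′ , s , e , π , τ =
    l′ , as ++ bs , s , e , mk∼
      (↭-trans (map⁺ edge (shift l as bs)) (subst (λ z → map edge (l ∷ as ++ bs) ↭ z ∷ map edge (as ++ bs)) (sym e) ↭-refl))
      (λ y → ≡.trans (parity-↭ (shift l as bs) y) (cong (_xor parity (as ++ bs) y) (π y))) , τ

  odd⇒touched : ∀ ls x → parity ls x ≡ true → ∃ λ l → l ∈ ls × Touches x l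
  odd⇒touched (l ∷ ls) x p with touches? x l
  ... | yes t = l , here refl , t
  ... | no ¬t with odd⇒touched ls x (≡.trans (sym (cong (_xor parity ls x) untouched)) p)
    where
    untouched : linkParity l x ≡ false
    untouched rewrite δ-≢ (¬t ∘ inj₁) | δ-≢ (¬t ∘ inj₂) = refl
  ...   | k , k∈ , t = k , there k∈ , t

  ∼-length : ∀ {xs ys} → xs ∼ ys → length xs ≡ length ys
  ∼-length {xs} {ys} s =
    ≡.trans (sym (length-map edge xs)) (≡.trans (↭-length (_∼_.edges s)) (length-map edge ys))

  -- Taking away a link that leaves `a` moves one odd end from `a` to the target; `t` is the part of
  -- the parity that stays.
  rest-parity : ∀ {a} {l ls ls′} (t : Fin n → Bool) → src l ≡ a → ls ∼ (l ∷ ls′) →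
    (∀ x → parity ls x ≡ δ a x xor t x) → ∀ x → parity ls′ x ≡ δ (tgt l) x xor t x
  rest-parity {l = l} {ls′ = ls′} t refl s π x =
    cancel (δ (src l) x) (δ (tgt l) x) (parity ls′ x) (t x) (≡.trans (sym (_∼_.parities s x)) (π x))
    where
    cancel : ∀ a b p t → (a xor b) xor p ≡ a xor t → p ≡ b xor t
    cancel false false p t eq = eq
    cancel false true  false true  eq = refl
    cancel false true  true  false eq = refl
    cancel true  false false false eq = refl
    cancel true  false true  true  eq = refl
    cancel true  true  false true  eq = refl
    cancel true  true  true  false eq = refl

  -- Greedy walk: while `a` differs from `b`, it is odd, so some link leaves it, and taking that
  -- link moves the odd end to its target. The list shrinks, so the walk reaches `b`, and what
  -- remains is even. The recursion is on the length because `pull` rearranges the list.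
  trail-between : ∀ d ls → length ls ≡ d → ∀ a b → (∀ x → parity ls x ≡ δ a x xor δ b x) →
    ∃₂ λ qs rs → Chain a qs b × qs ++ rs ≈ₑ ls × Even rs
  trail-between d ls ∣ls∣ a b π with a ≟ b
  ... | yes refl = [] , ls , refl , ↭-refl , λ x → ≡.trans (π x) (xor-same (δ a x))
  ... | no a≢b with odd⇒touched ls a (≡.trans (π a) (≡.cong₂ _xor_ (δ-refl a) (δ-≢ (a≢b ∘ sym))))
  ...   | l , l∈ , t with pull l∈ t
  trail-between zero    []      refl  a b π | no a≢b | l , () , t | _
  trail-between (suc d) ls ∣ls∣ a b π | no a≢b | l , l∈ , t | l′ , ls′ , refl , e , s , _
    with trail-between d ls′ (suc-injective (≡.trans (sym (∼-length s)) ∣ls∣)) (tgt l′) b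
           (rest-parity (δ b) refl s π)
  ... | qs , rs , c , p , ev =
    l′ ∷ qs , rs , (refl , c) , ↭-trans (prep _ p) (↭-sym (_∼_.edges s)) , ev

  -- The handshake lemma by the same walk: a single odd vertex has a link to leave by, and its other
  -- end becomes the single odd vertex, until no link is left.
  no-single-odd : ∀ d ls → length ls ≡ d → ∀ a → (∀ x → parity ls x ≡ δ a x) → ⊥
  no-single-odd d ls ∣ls∣ a π with odd⇒touched ls a (≡.trans (π a) (δ-refl a))
  ... | l , l∈ , t with pull l∈ t
  no-single-odd zero    []      refl  a π | l , () , t | _
  no-single-odd (suc d) ls ∣ls∣ a π | l , l∈ , t | l′ , ls′ , refl , e , s , _ =
    no-single-odd d ls′ (suc-injective (≡.trans (sym (∼-length s)) ∣ls∣)) (tgt l′)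
      (λ x → ≡.trans (rest-parity (λ _ → false) refl s (λ y → ≡.trans (π y) (sym (xor-identityʳ _))) x) (xor-identityʳ _))

-- Closed trails and the surgeries that enlarge them.

module Growth {n m : ℕ} (E : Hypergraph n m) where
  open Trails E
  open import Algebra.Solver.CommutativeMonoid (++-commutativeMonoid {A = Link}) using (solve; _⊜_; _⊕_)

  -- A closed trail is even by itself, so the parity condition concerns `rest`. By `covers`, every
  -- edge carries exactly one link.
  record Config : Set where
    field
      root   : Fin n
      trail  : List Link
      rest   : List Link
      closed : Chain root trail root
      even   : Even rest
      covers : map edge (trail ++ rest) ↭ allFin m

  open Config public

  -- The root counts even when the trail is empty, so the visited set is never empty.
  Visited : Fin n → Config → Set
  Visited x c = root c ≡ x ⊎ Any (Touches x) (trail c)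

  -- Kept from unfolding so that `with visited? x c` matches its occurrences.
  abstract
    visited? : ∀ x c → Dec (Visited x c)
    visited? x c = (root c ≟ x) ⊎-dec any? (touches? x) (trail c)

  chain-cut : ∀ {x y u} ls → Chain x ls y → x ≡ u ⊎ Any (Touches u) ls →
    ∃₂ λ as bs → ls ≡ as ++ bs × Chain x as u × Chain u bs y
  chain-cut ls       c       (inj₁ refl)                   = [] , ls , refl , refl , c
  chain-cut (l ∷ ls) (p , c) (inj₂ (here (inj₁ s)))        = [] , l ∷ ls , refl , ≡.trans (sym p) s , s , c
  chain-cut (l ∷ ls) (p , c) (inj₂ (here (inj₂ t)))
    with chain-cut ls c (inj₁ t)
  ... | as , bs , refl , d , d′ = l ∷ as , bs , refl , (p , d) , d′
  chain-cut (l ∷ ls) (p , c) (inj₂ (there a))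
    with chain-cut ls c (inj₂ a)
  ... | as , bs , refl , d , d′ = l ∷ as , bs , refl , (p , d) , d′

  -- Without `l`, the odd vertices of the even rest are exactly the two ends of `l`, so a trail
  -- leads from its target back to its source.
  rest-trail : ∀ c {l ls} → rest c ∼ (l ∷ ls) →
    ∃₂ λ qs rs → Chain (tgt l) qs (src l) × qs ++ rs ≈ₑ ls × Even rs
  rest-trail c {l} {ls} s = trail-between (length ls) ls refl (tgt l) (src l)
    (rest-parity (δ (src l)) refl s (λ x → ≡.trans (even c x) (sym (xor-same (δ (src l) x)))))

  private
    longer : ∀ (as bs cs : List Link) l → length (as ++ bs) < length (as ++ (l ∷ cs) ++ bs)
    longer []       bs cs l = s≤s (≤-trans (m≤n+m _ (length cs)) (≤-reflexive (sym (length-++ cs))))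
    longer (a ∷ as) bs cs l = s≤s (longer as bs cs l)

  -- The link `l` followed by the trail from `rest-trail` is closed, and is inserted where the main
  -- trail passes `src l`.
  absorb : ∀ c {l ls} → Visited (src l) c → rest c ∼ (l ∷ ls) →
    ∃ λ c′ → length (trail c) < length (trail c′)
  absorb c {l} {ls} vis s with chain-cut (trail c) (closed c) vis | rest-trail c s
  ... | as , bs , eq , d , d′ | qs , rs , q , p , ev =
    record
      { root   = root c
      ; trail  = as ++ (l ∷ qs) ++ bs
      ; rest   = rs
      ; closed = chain-++ as d (refl , chain-++ qs q d′)
      ; even   = ev
      ; covers = ↭-trans perm (covers c)
      }
    , subst (λ t → length t < _) (sym eq) (longer as bs qs l)
    where
    perm : (as ++ (l ∷ qs) ++ bs) ++ rs ≈ₑ trail c ++ rest c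
    perm = ↭-trans
      (map⁺ edge (solve 5 (λ a x q b r → (a ⊕ (x ⊕ q) ⊕ b) ⊕ r ⊜ (a ⊕ b) ⊕ x ⊕ (q ⊕ r)) ↭-refl as [ l ] qs bs rs))
      (subst (λ t → (as ++ bs) ++ l ∷ (qs ++ rs) ≈ₑ t ++ rest c) (sym eq)
        (++-congʳ (as ++ bs) (↭-trans (prep (edge l) p) (↭-sym (_∼_.edges s)))))

  redirect : ∀ {v} l → v ∈ₛ E (edge l) → v ≢ tgt l → Link
  redirect {v} l v∈ v≢ = record l { src = v ; src∈ = v∈ ; src≢tgt = v≢ }

  -- Let `w` run from u to x in the trail and `l` from v to y outside. With the sources swapped, the
  -- trail goes from u to y, through the rest from y to v, and on to x. The inequalities keep the
  -- new links from being loops.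
  exchange : ∀ c {as w bs l ls} → trail c ≡ as ++ w ∷ bs → rest c ∼ (l ∷ ls) →
    src l ∈ₛ E (edge w) → src l ≢ tgt w → src w ∈ₛ E (edge l) → src w ≢ tgt l →
    ∃ λ c′ → length (trail c) < length (trail c′)
  exchange c {as} {w} {bs} {l} {ls} eq s v∈w v≢ u∈l u≢
    with chain-split as (subst (λ t → Chain _ t _) eq (closed c)) | rest-trail c s
  ... | _ , d , (refl , d′) | qs , rs , q , p , ev =
    record
      { root   = root c
      ; trail  = as ++ (l′ ∷ qs) ++ w′ ∷ bs
      ; rest   = rs
      ; closed = chain-++ as d (refl , chain-++ qs q (refl , d′))
      ; even   = ev
      ; covers = ↭-trans perm (covers c)
      }
    , subst (λ t → length t < length (as ++ (l′ ∷ qs) ++ w′ ∷ bs)) (sym eq)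
        (subst (_< length (as ++ (l′ ∷ qs) ++ w′ ∷ bs)) same-length (longer as (w′ ∷ bs) qs l′))
    where
    l′ = redirect l u∈l u≢
    w′ = redirect w v∈w v≢
    same-length : length (as ++ w′ ∷ bs) ≡ length (as ++ w ∷ bs)
    same-length = ≡.trans (length-++ as) (sym (length-++ as))
    perm : (as ++ (l′ ∷ qs) ++ w′ ∷ bs) ++ rs ≈ₑ trail c ++ rest c
    perm = ↭-trans
      (map⁺ edge (solve 6 (λ a x q y b r → (a ⊕ (x ⊕ q) ⊕ y ⊕ b) ⊕ r ⊜ (a ⊕ y ⊕ b) ⊕ x ⊕ (q ⊕ r)) ↭-refl
        as [ l′ ] qs [ w′ ] bs rs))
      (↭-trans (++-congˡ (l′ ∷ qs ++ rs) (++-congʳ as {w′ ∷ bs} {w ∷ bs} ↭-refl))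
        (subst (λ t → (as ++ w ∷ bs) ++ l′ ∷ (qs ++ rs) ≈ₑ t ++ rest c) (sym eq)
          (++-congʳ (as ++ w ∷ bs) (↭-trans (prep (edge l) p) (↭-sym (_∼_.edges s))))))

  -- Moving one end of two links from `v` to `u` changes the parity at each of these vertices twice,
  -- so the rest stays even. The first new link starts at the visited `u` and can be absorbed.
  shift-two : ∀ c {as l₁ bs l₂ cs u v} → rest c ≡ as ++ l₁ ∷ bs ++ l₂ ∷ cs →
    Touches v l₁ → Touches v l₂ → u ∈ₛ E (edge l₁) → u ∈ₛ E (edge l₂) →
    ¬ Touches u l₁ → ¬ Touches u l₂ → Visited u c →
    ∃ λ c′ → length (trail c) < length (trail c′)
  shift-two c {as} {l₁} {bs} {l₂} {cs} {u} {v} eq t₁ t₂ u∈₁ u∈₂ u∉₁ u∉₂ vis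
    with orient l₁ t₁ | orient l₂ t₂
  ... | k₁ , refl , refl , π₁ , τ₁ | k₂ , s₂ , refl , π₂ , τ₂ =
    absorb c {r₁} {r₂ ∷ as ++ bs ++ cs} vis (mk∼ edges parities)
    where
    r₁ = redirect k₁ u∈₁ (λ p → u∉₁ (τ₁ (inj₂ (sym p))))
    r₂ = redirect k₂ u∈₂ (λ p → u∉₂ (τ₂ (inj₂ (sym p))))
    perm : rest c ↭ l₁ ∷ l₂ ∷ as ++ bs ++ cs
    perm = subst (_↭ (l₁ ∷ l₂ ∷ as ++ bs ++ cs)) (sym eq)
      (solve 5 (λ a x b y c → a ⊕ x ⊕ b ⊕ y ⊕ c ⊜ x ⊕ y ⊕ a ⊕ b ⊕ c) ↭-refl as [ l₁ ] bs [ l₂ ] cs)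
    edges : rest c ≈ₑ r₁ ∷ r₂ ∷ as ++ bs ++ cs
    edges = map⁺ edge perm
    parities : ∀ x → parity (rest c) x ≡ parity (r₁ ∷ r₂ ∷ as ++ bs ++ cs) x
    parities x = ≡.trans (parity-↭ perm x)
      (≡.trans (cong₂ (λ p q → p xor (q xor parity (as ++ bs ++ cs) x))
          (π₁ x) (≡.trans (π₂ x) (cong (λ w → δ w x xor δ (tgt k₂) x) s₂)))
        (swap-base (δ (src k₁) x) (δ u x) (δ (tgt k₁) x) (δ (tgt k₂) x) _))
      where
      collect : ∀ a b c d → (a xor b) xor ((a xor c) xor d) ≡ b xor (c xor d)
      collect false b c d = refl
      collect true  b c d = flips b c d
        where
        flips : ∀ b c d → (true xor b) xor ((true xor c) xor d) ≡ b xor (c xor d)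
        flips false false false = refl
        flips false false true  = refl
        flips false true  d     = refl
        flips true  false false = refl
        flips true  false true  = refl
        flips true  true  false = refl
        flips true  true  true  = refl
      swap-base : ∀ v u b c d → (v xor b) xor ((v xor c) xor d) ≡ (u xor b) xor ((u xor c) xor d)
      swap-base v u b c d = ≡.trans (collect v b c d) (sym (collect u b c d))

  touched-reversed : ∀ {x} ls → Any (Touches x) ls → Any (Touches x) (reversed ls)
  touched-reversed (l ∷ ls) (here (inj₁ s)) = ++⁺ʳ (reversed ls) (here (inj₂ s))
  touched-reversed (l ∷ ls) (here (inj₂ t)) = ++⁺ʳ (reversed ls) (here (inj₁ t))
  touched-reversed (l ∷ ls) (there a)       = ++⁺ˡ (touched-reversed ls a)

  start-touched : ∀ {x y} ls {l rs} → Chain x (ls ++ l ∷ rs) y → Any (Touches x) (ls ++ l ∷ rs)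
  start-touched []       (p , _) = here (inj₁ p)
  start-touched (k ∷ ls) (p , _) = here (inj₁ p)

  end-touched : ∀ {x y} ls → Chain x ls y → x ≡ y ⊎ Any (Touches y) ls
  end-touched []       p       = inj₁ p
  end-touched (l ∷ ls) (_ , c) with end-touched ls c
  ... | inj₁ t = inj₂ (here (inj₂ t))
  ... | inj₂ a = inj₂ (there a)

  -- The second kind of progress: the trail does not lengthen, but it visits more vertices.
  record Extends (c : Config) (v : Fin n) (c′ : Config) : Set where
    field
      same-length : length (trail c) ≡ length (trail c′)
      keeps       : ∀ {x} → Visited x c → Visited x c′
      gains       : Visited v c′

  -- Let the two links run from u to x and from u to y. The new trail starts at `v`, goes to x,
  -- follows `bs` to u, traverses `cs ++ as` backwards from u to y, and returns to `v`.
  reroute : ∀ c {as l₁ bs l₂ cs v} → trail c ≡ as ++ l₁ ∷ bs ++ l₂ ∷ cs → src l₁ ≡ src l₂ →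
    v ∈ₛ E (edge l₁) → v ∈ₛ E (edge l₂) → ¬ Visited v c → ∃ (Extends c v)
  reroute c {as} {l₁} {bs} {l₂} {cs} {v} eq s₁≡s₂ v∈₁ v∈₂ ¬vis
    with chain-split as (subst (λ t → Chain _ t _) eq (closed c))
  ... | _ , d , (refl , d′) with chain-split bs d′
  ...   | _ , d₁ , (refl , d₂) = c′ , record
    { same-length = ≡.trans (sym (length-map edge (trail c)))
        (≡.trans (↭-length (↭-sym trail-perm)) (length-map edge new))
    ; keeps = keep
    ; gains = inj₁ refl
    }
    where
    untouched : ∀ {l} → l ∈ trail c → v ≢ tgt l
    untouched l∈ refl = ¬vis (inj₂ (Any.map (λ { refl → inj₂ refl }) l∈))
    l₁∈ : l₁ ∈ trail c
    l₁∈ = subst (l₁ ∈_) (sym eq) (++⁺ʳ as (here refl))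
    l₂∈ : l₂ ∈ trail c
    l₂∈ = subst (l₂ ∈_) (sym eq) (++⁺ʳ as (there (++⁺ʳ bs (here refl))))
    k₁ = redirect l₁ v∈₁ (untouched {l₁} l₁∈)
    k₂ = flip (redirect l₂ v∈₂ (untouched {l₂} l₂∈))
    new = k₁ ∷ bs ++ reversed (cs ++ as) ++ [ k₂ ]
    trail-perm : new ≈ₑ trail c
    trail-perm = subst (new ≈ₑ_) (sym eq) (↭-trans
      (prep _ (++-congʳ bs (++-congˡ [ k₂ ] (reversed-≈ₑ (cs ++ as)))))
      (↭-trans
        (map⁺ edge (solve 5 (λ x b c a y → x ⊕ b ⊕ (c ⊕ a) ⊕ y ⊜ a ⊕ x ⊕ b ⊕ y ⊕ c) ↭-refl
          [ k₁ ] bs cs as [ k₂ ]))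
        (++-congʳ as (prep _ (++-congʳ bs {k₂ ∷ cs} {l₂ ∷ cs} ↭-refl)))))
    c′ : Config
    c′ = record
      { root   = v
      ; trail  = new
      ; rest   = rest c
      ; closed = refl , chain-++ bs d₁ (chain-++ (reversed (cs ++ as))
          (subst (λ u → Chain u (reversed (cs ++ as)) (tgt l₂)) s₁≡s₂ (chain-reversed (cs ++ as) (chain-++ cs d₂ d)))
          (refl , refl))
      ; even   = even c
      ; covers = ↭-trans (++-congˡ {new} {trail c} (rest c) trail-perm) (covers c)
      }
    -- The common source loses both links but remains the end of `bs`, or the target of `k₁` if `bs`
    -- is empty.
    hub : ∀ {x} → src l₂ ≡ x → Any (Touches x) new
    hub refl with end-touched bs d₁
    ... | inj₁ t = here (inj₂ t)
    ... | inj₂ a = there (++⁺ˡ a)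
    keep-touched : ∀ {x} → Any (Touches x) (as ++ l₁ ∷ bs ++ l₂ ∷ cs) → Any (Touches x) new
    keep-touched a with ++⁻ as a
    ... | inj₁ a∈as = there (++⁺ʳ bs (++⁺ˡ (touched-reversed (cs ++ as) (++⁺ʳ cs a∈as))))
    ... | inj₂ (here (inj₁ s)) = hub (≡.trans (sym s₁≡s₂) s)
    ... | inj₂ (here (inj₂ t)) = here (inj₂ t)
    ... | inj₂ (there a′) with ++⁻ bs a′
    ...   | inj₁ a∈bs             = there (++⁺ˡ a∈bs)
    ...   | inj₂ (here (inj₁ s)) = hub s
    ...   | inj₂ (here (inj₂ t)) = there (++⁺ʳ bs (++⁺ʳ (reversed (cs ++ as)) (here (inj₁ t))))
    ...   | inj₂ (there a∈cs)    = there (++⁺ʳ bs (++⁺ˡ (touched-reversed (cs ++ as) (++⁺ˡ a∈cs))))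
    keep : ∀ {x} → Visited x c → Visited x c′
    -- The root moves to `v`; the old root is still met, being the start of a nonempty trail.
    keep (inj₁ refl) = inj₂ (keep-touched (start-touched as (subst (λ t → Chain (root c) t (root c)) eq (closed c))))
    keep (inj₂ a)    = inj₂ (keep-touched (subst (Any (Touches _)) eq a))

  reverseConfig : Config → Config
  reverseConfig c = record
    { root   = root c
    ; trail  = reversed (trail c)
    ; rest   = rest c
    ; closed = chain-reversed (trail c) (closed c)
    ; even   = even c
    ; covers = ↭-trans (++-congˡ {reversed (trail c)} {trail c} (rest c) (reversed-≈ₑ (trail c))) (covers c)
    }

  -- Reversing the trail turns common targets into common sources and exchanges the order of the two
  -- links.
  reroute-in : ∀ c {as l₁ bs l₂ cs v} → trail c ≡ as ++ l₁ ∷ bs ++ l₂ ∷ cs → tgt l₁ ≡ tgt l₂ →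
    v ∈ₛ E (edge l₁) → v ∈ₛ E (edge l₂) → ¬ Visited v c → ∃ (Extends c v)
  reroute-in c {as} {l₁} {bs} {l₂} {cs} {v} eq t₁≡t₂ v∈₁ v∈₂ ¬vis
    with reroute (reverseConfig c) {reversed cs} {flip l₂} {reversed bs} {flip l₁} {reversed as}
           decomposition (sym t₁≡t₂) v∈₂ v∈₁ (¬vis ∘ back)
    where
    decomposition : reversed (trail c) ≡ reversed cs ++ flip l₂ ∷ reversed bs ++ flip l₁ ∷ reversed as
    decomposition rewrite eq | reversed-++ as (l₁ ∷ bs ++ l₂ ∷ cs) | reversed-++ bs (l₂ ∷ cs)
      | ++-assoc (reversed cs) [ flip l₂ ] (reversed bs)
      | ++-assoc (reversed cs ++ flip l₂ ∷ reversed bs) [ flip l₁ ] (reversed as)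
      | ++-assoc (reversed cs) (flip l₂ ∷ reversed bs) (flip l₁ ∷ reversed as) = refl
    untouch : ∀ {x} ls → Any (Touches x) (reversed ls) → Any (Touches x) ls
    untouch (l ∷ ls) a with ++⁻ (reversed ls) a
    ... | inj₁ a′              = there (untouch ls a′)
    ... | inj₂ (here (inj₁ t)) = here (inj₂ t)
    ... | inj₂ (here (inj₂ s)) = here (inj₁ s)
    back : Visited v (reverseConfig c) → Visited v c
    back (inj₁ p) = inj₁ p
    back (inj₂ a) = inj₂ (untouch (trail c) a)
  ... | c′ , ext = c′ , record
    { same-length = ≡.trans
        (≡.trans (sym (length-map edge (trail c)))
          (≡.trans (↭-length (↭-sym (reversed-≈ₑ (trail c)))) (length-map edge (reversed (trail c)))))
        (Extends.same-length ext)
    ; keeps = λ { (inj₁ p) → Extends.keeps ext (inj₁ p)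
                ; (inj₂ a) → Extends.keeps ext (inj₂ (touched-reversed (trail c) a)) }
    ; gains = Extends.gains ext
    }

-- Double counting of crossing pairs, and termination.

codegree : ∀ {n m} → Hypergraph n m → Fin n → Fin n → ℕ
codegree {m = m} E u v = ∑ (allFin m) (λ e → 𝟙 (u ∈? E e) * 𝟙 (v ∈? E e))

0<*⇒ : ∀ a b → 0 < a * b → 0 < a × 0 < b
0<*⇒ (suc a) (suc b) _ = s≤s z≤n , s≤s z≤n
0<*⇒ (suc a) zero    p = contradiction (subst (0 <_) (*-zeroʳ a) p) λ ()

*-≤-suc : ∀ {a b k} → a + b ≤ suc k → a * b ≤ k * b
*-≤-suc {a} {zero} {k} le = ≤-reflexive (≡.trans (*-zeroʳ a) (sym (*-zeroʳ k)))
*-≤-suc {a} {suc b} le = *-monoˡ-≤ (suc b) (s≤s⁻¹ (≤-trans (≤-trans (s≤s (m≤m+n a b)) (≤-reflexive (sym (+-suc a b)))) le))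

-- If no summand reaches 2, all three are 1. The summands will count outgoing trail links, incoming
-- trail links and outside links, and the four outcomes match the four surgeries.
three-of-three : ∀ a b c → 3 ≤ a + b + c → 2 ≤ a ⊎ 2 ≤ b ⊎ 2 ≤ c ⊎ (0 < a × 0 < c)
three-of-three (suc (suc a)) b             c             _ = inj₁ (s≤s (s≤s z≤n))
three-of-three _             (suc (suc b)) c             _ = inj₂ (inj₁ (s≤s (s≤s z≤n)))
three-of-three _             _             (suc (suc c)) _ = inj₂ (inj₂ (inj₁ (s≤s (s≤s z≤n))))
three-of-three 1 _ 1 _ = inj₂ (inj₂ (inj₂ (s≤s z≤n , s≤s z≤n)))
three-of-three 0 0 0 ()
three-of-three 0 0 1 (s≤s ())
three-of-three 0 1 0 (s≤s ())
three-of-three 0 1 1 (s≤s (s≤s ()))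
three-of-three 1 0 0 (s≤s ())
three-of-three 1 1 0 (s≤s (s≤s ()))

-- The edge sizes are bounded by `suc k`, so `k` is here one less than the rank.
module Progress {n m : ℕ} (E : Hypergraph n m) (k : ℕ)
  (size≤ : ∀ e → ∣ E e ∣ ≤ suc k) (codegree≥ : ∀ {u v} → u ≢ v → suc k ≤ codegree E u v) where
  open Trails E
  open Growth E

  src-visited : ∀ c {l} → l ∈ trail c → Visited (src l) c
  src-visited c l∈ = inj₂ (Any.map (λ { refl → inj₁ refl }) l∈)

  tgt-visited : ∀ c {l} → l ∈ trail c → Visited (tgt l) c
  tgt-visited c l∈ = inj₂ (Any.map (λ { refl → inj₂ refl }) l∈)

  ∑-endpoints : ∀ (f : Fin n → ℕ) s t → ∑ (allFin n) (λ x → f x * (𝟙 (s ≟ x) + 𝟙 (t ≟ x))) ≡ f s + f t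
  ∑-endpoints f s t = begin
    ∑ (allFin n) (λ x → f x * (𝟙 (s ≟ x) + 𝟙 (t ≟ x)))
      ≡⟨ ∑-cong (allFin n) (λ x → ≡.trans (*-comm (f x) _) (*-distribʳ-+ (f x) (𝟙 (s ≟ x)) _)) ⟩
    ∑ (allFin n) (λ x → 𝟙 (s ≟ x) * f x + 𝟙 (t ≟ x) * f x)
      ≡⟨ ∑-+ (allFin n) (λ x → 𝟙 (s ≟ x) * f x) _ ⟩
    ∑ (allFin n) (λ x → 𝟙 (s ≟ x) * f x) + ∑ (allFin n) (λ x → 𝟙 (t ≟ x) * f x)
      ≡⟨ cong₂ _+_ (∑-δ s f) (∑-δ t f) ⟩
    f s + f t ∎
    where open ≡.≡-Reasoning

  -- The stuck situation: no outside link meets the trail, yet the vertex `w` is missed.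
  module _ (c : Config) (rest-unvisited : ∀ {l x} → l ∈ rest c → Touches x l → ¬ Visited x c)
    {w} (w-unvisited : ¬ Visited w c) where

    σ τ : Fin n → ℕ
    σ x = 𝟙 (visited? x c)
    τ x = 𝟙 (¬? (visited? x c))

    pairs : List (Fin n × Fin n)
    pairs = cartesianProduct (allFin n) (allFin n)

    D : Fin n × Fin n → ℕ
    D (u , v) = σ u * τ v

    joint : Link → Fin n × Fin n → ℕ
    joint l (u , v) = 𝟙 (u ∈? E (edge l)) * 𝟙 (v ∈? E (edge l))

    -- A link counts when one of its ends can be moved across the pair: from u to v on the trail,
    -- from v to u outside it.
    usefulTrail usefulRest : Link → Fin n × Fin n → ℕ
    usefulTrail l (u , v) = (𝟙 (src l ≟ u) + 𝟙 (tgt l ≟ u)) * 𝟙 (v ∈? E (edge l))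
    usefulRest  l (u , v) = 𝟙 (u ∈? E (edge l)) * (𝟙 (src l ≟ v) + 𝟙 (tgt l ≟ v))

    inner outer : Link → ℕ
    inner l = ∑ (allFin n) (λ u → σ u * 𝟙 (u ∈? E (edge l)))
    outer l = ∑ (allFin n) (λ v → τ v * 𝟙 (v ∈? E (edge l)))

    inner+outer≤ : ∀ l → inner l + outer l ≤ suc k
    inner+outer≤ l = begin
      inner l + outer l                                       ≡⟨ ∑-+ (allFin n) _ _ ⟨
      ∑ (allFin n) (λ x → σ x * 𝟙 (x ∈? e) + τ x * 𝟙 (x ∈? e)) ≡⟨ ∑-cong (allFin n) split ⟩
      ∑ (allFin n) (λ x → 𝟙 (x ∈? e))                         ≡⟨ ∑-∈ e ⟩
      ∣ e ∣                                                   ≤⟨ size≤ (edge l) ⟩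
      suc k                                                   ∎
      where
      open ≤-Reasoning
      e = E (edge l)
      split : ∀ x → σ x * 𝟙 (x ∈? e) + τ x * 𝟙 (x ∈? e) ≡ 𝟙 (x ∈? e)
      split x with visited? x c
      ... | yes _ = ≡.trans (+-identityʳ _) (+-identityʳ _)
      ... | no _  = +-identityʳ _

    separate : ∀ (f g : Fin n → ℕ) →
      ∑ pairs (λ (u , v) → D (u , v) * (f u * g v)) ≡
      ∑ (allFin n) (λ u → σ u * f u) * ∑ (allFin n) (λ v → τ v * g v)
    separate f g = ≡.trans
      (∑-cong pairs (λ (u , v) → [m*n]*[o*p]≡[m*o]*[n*p] (σ u) (τ v) (f u) (g v)))
      (∑-× (allFin n) (allFin n) (λ u → σ u * f u) (λ v → τ v * g v))

    -- An edge with a visited and b unvisited vertices has ab crossing pairs. Both ends of a trail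
    -- link are visited, so it is useful for 2b of them, and `a * b ≤ k * b` because a is at most
    -- `k` unless b is 0.
    joint≤trail : ∀ {l} → l ∈ trail c →
      2 * ∑ pairs (λ p → D p * joint l p) ≤ k * ∑ pairs (λ p → D p * usefulTrail l p)
    joint≤trail {l} l∈ = begin
      2 * ∑ pairs (λ p → D p * joint l p)       ≡⟨ cong (2 *_) (separate _ _) ⟩
      2 * (inner l * outer l)                   ≤⟨ *-monoʳ-≤ 2 (*-≤-suc {inner l} (inner+outer≤ l)) ⟩
      2 * (k * outer l)                         ≡⟨ *-assoc 2 k _ ⟨
      2 * k * outer l                           ≡⟨ cong (_* outer l) (*-comm 2 k) ⟩
      k * 2 * outer l                           ≡⟨ *-assoc k 2 _ ⟩
      k * (2 * outer l)                         ≡⟨ cong (λ t → k * (t * outer l)) two ⟨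
      k * (ends * outer l)                      ≡⟨ cong (k *_) (separate (λ u → 𝟙 (src l ≟ u) + 𝟙 (tgt l ≟ u)) _) ⟨
      k * ∑ pairs (λ p → D p * usefulTrail l p) ∎
      where
      open ≤-Reasoning
      ends = ∑ (allFin n) (λ u → σ u * (𝟙 (src l ≟ u) + 𝟙 (tgt l ≟ u)))
      two : ends ≡ 2
      two = ≡.trans (∑-endpoints σ (src l) (tgt l))
        (cong₂ _+_ (𝟙-yes (visited? _ c) (src-visited c l∈)) (𝟙-yes (visited? _ c) (tgt-visited c l∈)))

    -- The same count with the roles exchanged: both ends are unvisited, so the link is useful for
    -- 2a pairs.
    joint≤rest : ∀ {l} → l ∈ rest c →
      2 * ∑ pairs (λ p → D p * joint l p) ≤ k * ∑ pairs (λ p → D p * usefulRest l p)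
    joint≤rest {l} l∈ = begin
      2 * ∑ pairs (λ p → D p * joint l p)      ≡⟨ cong (2 *_) (separate _ _) ⟩
      2 * (inner l * outer l)                  ≡⟨ cong (2 *_) (*-comm (inner l) _) ⟩
      2 * (outer l * inner l)                  ≤⟨ *-monoʳ-≤ 2 (*-≤-suc {outer l}
                                                    (≤-trans (≤-reflexive (+-comm (outer l) _)) (inner+outer≤ l))) ⟩
      2 * (k * inner l)                        ≡⟨ *-comm 2 (k * inner l) ⟩
      k * inner l * 2                          ≡⟨ *-assoc k _ 2 ⟩
      k * (inner l * 2)                        ≡⟨ cong (λ t → k * (inner l * t)) two ⟨
      k * (inner l * ends)                     ≡⟨ cong (k *_) (separate _ (λ v → 𝟙 (src l ≟ v) + 𝟙 (tgt l ≟ v))) ⟨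
      k * ∑ pairs (λ p → D p * usefulRest l p) ∎
      where
      open ≤-Reasoning
      ends = ∑ (allFin n) (λ v → τ v * (𝟙 (src l ≟ v) + 𝟙 (tgt l ≟ v)))
      two : ends ≡ 2
      two = ≡.trans (∑-endpoints τ (src l) (tgt l))
        (cong₂ _+_ (𝟙-yes (¬? (visited? _ c)) (rest-unvisited l∈ (inj₁ refl)))
                   (𝟙-yes (¬? (visited? _ c)) (rest-unvisited l∈ (inj₂ refl))))

    useful : Fin n × Fin n → ℕ
    useful p = ∑ (trail c) (λ l → usefulTrail l p) + ∑ (rest c) (λ l → usefulRest l p)

    codegree-links : ∀ u v → codegree E u v ≡ ∑ (trail c) (λ l → joint l (u , v)) + ∑ (rest c) (λ l → joint l (u , v))
    codegree-links u v = begin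
      codegree E u v                                  ≡⟨ ∑-↭ inc (covers c) ⟨
      ∑ (map edge (trail c ++ rest c)) inc            ≡⟨ ∑-map edge (trail c ++ rest c) inc ⟩
      ∑ (trail c ++ rest c) (λ l → joint l (u , v))   ≡⟨ ∑-++ (trail c) (rest c) _ ⟩
      ∑ (trail c) (λ l → joint l (u , v)) + ∑ (rest c) (λ l → joint l (u , v)) ∎
      where
      open ≡.≡-Reasoning
      inc = λ e → 𝟙 (u ∈? E e) * 𝟙 (v ∈? E e)

    weigh : ∀ (ls : List Link) (g : Link → Fin n × Fin n → ℕ) →
      ∑ pairs (λ p → D p * ∑ ls (λ l → g l p)) ≡ ∑ ls (λ l → ∑ pairs (λ p → D p * g l p))
    weigh ls g = ≡.trans (∑-cong pairs (λ p → sym (∑-*ˡ ls (D p) (λ l → g l p)))) (∑-comm pairs ls _)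

    weigh₂ : ∀ (g h : Link → Fin n × Fin n → ℕ) →
      ∑ pairs (λ p → D p * (∑ (trail c) (λ l → g l p) + ∑ (rest c) (λ l → h l p))) ≡
      ∑ (trail c) (λ l → ∑ pairs (λ p → D p * g l p)) + ∑ (rest c) (λ l → ∑ pairs (λ p → D p * h l p))
    weigh₂ g h = ≡.trans (∑-cong pairs (λ p → *-distribˡ-+ (D p) (∑ (trail c) (λ l → g l p)) _))
      (≡.trans (∑-+ pairs (λ p → D p * ∑ (trail c) (λ l → g l p)) _)
        (cong₂ _+_ (weigh (trail c) g) (weigh (rest c) h)))

    D-codegree : ∀ p → suc k * D p ≤ D p * codegree E (proj₁ p) (proj₂ p)
    D-codegree (u , v) with visited? u c | visited? v c
    ... | yes a | no b  = ≤-trans (≤-reflexive (*-comm (suc k) 1)) (*-monoʳ-≤ 1 (codegree≥ {u} {v} λ { refl → b a }))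
    ... | yes a | yes b = ≤-reflexive (*-zeroʳ (suc k))
    ... | no a  | _     = ≤-reflexive (*-zeroʳ (suc k))

    double-count : 2 * (suc k * ∑ pairs D) ≤ k * ∑ pairs (λ p → D p * useful p)
    double-count = begin
      2 * (suc k * ∑ pairs D)
        ≡⟨ cong (2 *_) (∑-*ˡ pairs (suc k) D) ⟨
      2 * ∑ pairs (λ p → suc k * D p)
        ≤⟨ *-monoʳ-≤ 2 (∑-mono pairs (λ {p} _ → D-codegree p)) ⟩
      2 * ∑ pairs (λ p → D p * codegree E (proj₁ p) (proj₂ p))
        ≡⟨ cong (2 *_) (∑-cong pairs (λ p → cong (D p *_) (codegree-links (proj₁ p) (proj₂ p)))) ⟩
      2 * ∑ pairs (λ p → D p * (∑ (trail c) (λ l → joint l p) + ∑ (rest c) (λ l → joint l p)))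
        ≡⟨ cong (2 *_) (weigh₂ joint joint) ⟩
      2 * (∑ (trail c) J + ∑ (rest c) J)
        ≡⟨ *-distribˡ-+ 2 (∑ (trail c) J) _ ⟩
      2 * ∑ (trail c) J + 2 * ∑ (rest c) J
        ≡⟨ cong₂ _+_ (∑-*ˡ (trail c) 2 J) (∑-*ˡ (rest c) 2 J) ⟨
      ∑ (trail c) (λ l → 2 * J l) + ∑ (rest c) (λ l → 2 * J l)
        ≤⟨ +-mono-≤ (∑-mono (trail c) joint≤trail) (∑-mono (rest c) joint≤rest) ⟩
      ∑ (trail c) (λ l → k * T l) + ∑ (rest c) (λ l → k * R l)
        ≡⟨ cong₂ _+_ (∑-*ˡ (trail c) k T) (∑-*ˡ (rest c) k R) ⟩
      k * ∑ (trail c) T + k * ∑ (rest c) R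
        ≡⟨ *-distribˡ-+ k (∑ (trail c) T) _ ⟨
      k * (∑ (trail c) T + ∑ (rest c) R)
        ≡⟨ cong (k *_) (weigh₂ usefulTrail usefulRest) ⟨
      k * ∑ pairs (λ p → D p * useful p) ∎
      where
      open ≤-Reasoning
      J T R : Link → ℕ
      J l = ∑ pairs (λ p → D p * joint l p)
      T l = ∑ pairs (λ p → D p * usefulTrail l p)
      R l = ∑ pairs (λ p → D p * usefulRest l p)

    D-pos : 0 < ∑ pairs D
    D-pos = subst (0 <_) (sym (∑-× (allFin n) (allFin n) σ τ)) one≤
      where
      pos : ∀ (f : Fin n → ℕ) x → f x ≡ 1 → 1 ≤ ∑ (allFin n) f
      pos f x fx≡1 = subst (_< ∑ (allFin n) f) (∑-zero (allFin n))
        (∑-mono-< (allFin n) (λ _ → z≤n) (∈-allFin x) (≤-reflexive (sym fx≡1)))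
      one≤ : 1 ≤ ∑ (allFin n) σ * ∑ (allFin n) τ
      one≤ = *-mono-≤ (pos σ (root c) (𝟙-yes (visited? _ c) (inj₁ refl)))
                      (pos τ w (𝟙-yes (¬? (visited? _ c)) w-unvisited))

    -- By `double-count` the mean of `useful` over the crossing pairs exceeds 2, and the values are
    -- integers.
    useful-pair : ∃₂ λ u v → Visited u c × ¬ Visited v c × 3 ≤ useful (u , v)
    useful-pair with ∑-<⇒∃ pairs {λ p → 2 * D p} {λ p → D p * useful p} average
      where
      ΣDU = ∑ pairs (λ p → D p * useful p)
      2D = 2 * ∑ pairs D
      bound : suc k * 2D ≤ k * ΣDU
      bound = ≤-trans (≤-reflexive (≡.trans (sym (*-assoc (suc k) 2 (∑ pairs D)))
        (≡.trans (cong (_* ∑ pairs D) (*-comm (suc k) 2)) (*-assoc 2 (suc k) (∑ pairs D))))) double-count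
      -- Otherwise `suc k * 2D ≤ k * 2D`, although there is a crossing pair.
      average : ∑ pairs (λ p → 2 * D p) < ΣDU
      average = subst (_< ΣDU) (sym (∑-*ˡ pairs 2 D)) (≰⇒> λ ΣDU≤2D →
        <⇒≱ (m<n+m (k * 2D) (≤-trans D-pos (m≤n*m (∑ pairs D) 2))) (≤-trans bound (*-monoʳ-≤ k ΣDU≤2D)))
    ... | (u , v) , _ , lt with visited? u c | visited? v c
    ...   | yes a | no b  = u , v , a , b , subst (3 ≤_) (+-identityʳ (useful (u , v))) lt
    ...   | yes a | yes b = contradiction lt λ ()
    ...   | no a  | _     = contradiction lt λ ()

    grow : ∃ (λ c′ → length (trail c) < length (trail c′)) ⊎ ∃ λ v → ¬ Visited v c × ∃ (Extends c v)
    grow with useful-pair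
    ... | u , v , u-vis , v-unvis , 3≤ = cases (three-of-three (∑ (trail c) out) (∑ (trail c) into) (∑ (rest c) aside)
        (subst (3 ≤_) (cong (_+ ∑ (rest c) aside)
          (≡.trans (∑-cong (trail c) (λ l → *-distribʳ-+ (at l) (𝟙 (src l ≟ u)) _)) (∑-+ (trail c) out into))) 3≤))
      where
      at out into aside : Link → ℕ
      at l    = 𝟙 (v ∈? E (edge l))
      out l   = 𝟙 (src l ≟ u) * at l
      into l  = 𝟙 (tgt l ≟ u) * at l
      aside l = 𝟙 (u ∈? E (edge l)) * (𝟙 (src l ≟ v) + 𝟙 (tgt l ≟ v))
      -- The ends of a link are distinct, so a count of 2 must come from two links.
      endpoint≤1 : ∀ l → 𝟙 (src l ≟ v) + 𝟙 (tgt l ≟ v) ≤ 1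
      endpoint≤1 l with src l ≟ v | tgt l ≟ v
      ... | yes p | yes q = contradiction (≡.trans p (sym q)) (src≢tgt l)
      ... | yes _ | no _  = ≤-refl
      ... | no _  | yes _ = ≤-refl
      ... | no _  | no _  = z≤n
      both : ∀ {P Q : Set} (d : Dec P) (d′ : Dec Q) → 0 < 𝟙 d * 𝟙 d′ → P × Q
      both d d′ lt with 0<*⇒ (𝟙 d) (𝟙 d′) lt
      ... | a , b = 𝟙-pos⇒ d a , 𝟙-pos⇒ d′ b
      aside⇒ : ∀ l → 0 < aside l → u ∈ₛ E (edge l) × Touches v l
      aside⇒ l lt with 0<*⇒ (𝟙 (u ∈? E (edge l))) (𝟙 (src l ≟ v) + 𝟙 (tgt l ≟ v)) lt
      ... | a , b = 𝟙-pos⇒ (u ∈? E (edge l)) a , endpoint b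
        where
        endpoint : 0 < 𝟙 (src l ≟ v) + 𝟙 (tgt l ≟ v) → Touches v l
        endpoint lt′ with src l ≟ v | tgt l ≟ v
        ... | yes p | _     = inj₁ p
        ... | no _  | yes q = inj₂ q
        endpoint () | no _ | no _
      not-at-u : ∀ {l} → l ∈ rest c → ¬ Touches u l
      not-at-u l∈ t = rest-unvisited l∈ t u-vis
      cases : _ → _
      cases (inj₁ 2≤out) with ∑-≥2⇒split (trail c) (λ {l} _ → *-mono-≤ (𝟙-≤1 (src l ≟ u)) (𝟙-≤1 (v ∈? E (edge l)))) 2≤out
      ... | as , l₁ , bs , l₂ , cs , eq , p₁ , p₂
        with both (src l₁ ≟ u) (v ∈? E (edge l₁)) p₁ | both (src l₂ ≟ u) (v ∈? E (edge l₂)) p₂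
      ...   | s₁ , v∈₁ | s₂ , v∈₂ = inj₂ (v , v-unvis , reroute c eq (≡.trans s₁ (sym s₂)) v∈₁ v∈₂ v-unvis)
      cases (inj₂ (inj₁ 2≤in)) with ∑-≥2⇒split (trail c) (λ {l} _ → *-mono-≤ (𝟙-≤1 (tgt l ≟ u)) (𝟙-≤1 (v ∈? E (edge l)))) 2≤in
      ... | as , l₁ , bs , l₂ , cs , eq , p₁ , p₂
        with both (tgt l₁ ≟ u) (v ∈? E (edge l₁)) p₁ | both (tgt l₂ ≟ u) (v ∈? E (edge l₂)) p₂
      ...   | t₁ , v∈₁ | t₂ , v∈₂ = inj₂ (v , v-unvis , reroute-in c eq (≡.trans t₁ (sym t₂)) v∈₁ v∈₂ v-unvis)
      cases (inj₂ (inj₂ (inj₁ 2≤aside)))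
        with ∑-≥2⇒split (rest c) (λ {l} _ → *-mono-≤ (𝟙-≤1 (u ∈? E (edge l))) (endpoint≤1 l)) 2≤aside
      ... | as , l₁ , bs , l₂ , cs , eq , p₁ , p₂ with aside⇒ l₁ p₁ | aside⇒ l₂ p₂
      ...   | u∈₁ , t₁ | u∈₂ , t₂ = inj₁ (shift-two c eq t₁ t₂ u∈₁ u∈₂
                (not-at-u (subst (l₁ ∈_) (sym eq) (∈-++⁺ʳ as (here refl))))
                (not-at-u (subst (l₂ ∈_) (sym eq) (∈-++⁺ʳ as (there (∈-++⁺ʳ bs (here refl)))))) u-vis)
      cases (inj₂ (inj₂ (inj₂ (0<out , 0<aside)))) with ∑-pos⇒∃ (trail c) 0<out | ∑-pos⇒∃ (rest c) 0<aside
      ... | x , x∈ , p | l , l∈ , q with ∈-∃++ x∈ | both (src x ≟ u) (v ∈? E (edge x)) p | aside⇒ l q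
      ...   | as , bs , eq | refl , v∈x | u∈l , t with pull l∈ t
      ...     | l′ , ls , refl , refl , s , τ′ = inj₁ (exchange c eq s v∈x
                  (λ v≡ → v-unvis (subst (λ y → Visited y c) (sym v≡) (tgt-visited c x∈))) u∈l
                  (λ u≡ → not-at-u l∈ (τ′ (inj₂ (sym u≡)))))

  Complete : Config → Set
  Complete c = rest c ≡ [] × ∀ x → Visited x c

  unvisited : Config → ℕ
  unvisited c = ∑ (allFin n) (λ x → 𝟙 (¬? (visited? x c)))

  extends-unvisited : ∀ {c v c′} → ¬ Visited v c → Extends c v c′ → unvisited c′ < unvisited c
  extends-unvisited {c} {v} {c′} ¬vis ext = ∑-mono-< (allFin n)
    (λ x → 𝟙-mono (¬? (visited? x c′)) (¬? (visited? x c)) (_∘ Extends.keeps ext)) (∈-allFin v)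
    (subst₂ _<_ (sym (𝟙-no (¬? (visited? v c′)) (λ f → f (Extends.gains ext))))
                (sym (𝟙-yes (¬? (visited? v c)) ¬vis)) (s≤s z≤n))

  trail-length : ∀ c → length (trail c) ≤ m
  trail-length c = begin
    length (trail c)                             ≤⟨ m≤m+n _ _ ⟩
    length (trail c) + length (rest c)           ≡⟨ length-++ (trail c) ⟨
    length (trail c ++ rest c)                   ≡⟨ length-map edge (trail c ++ rest c) ⟨
    length (map edge (trail c ++ rest c))        ≡⟨ ↭-length (covers c) ⟩
    length (allFin m)                            ≡⟨ length-tabulate id ⟩
    m                                            ∎
    where open ≤-Reasoning

  -- A link of the rest that meets the trail is absorbed. If there is none and every vertex is
  -- visited, the rest is empty; if some vertex is missed, `grow` applies.
  step : ∀ c → Complete c ⊎ ∃ (λ c′ → length (trail c) < length (trail c′)) ⊎ ∃ λ v → ¬ Visited v c × ∃ (Extends c v)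
  step c with any? (λ l → visited? (src l) c) (rest c) | any? (λ l → visited? (tgt l) c) (rest c)
  ... | yes p | _ with find p
  ...   | l , l∈ , vis with pull l∈ (inj₁ refl)
  ...     | l′ , ls , s≡ , _ , s , _ = inj₂ (inj₁ (absorb c (subst (λ x → Visited x c) (sym s≡) vis) s))
  step c | no _ | yes p with find p
  ...   | l , l∈ , vis with pull l∈ (inj₂ refl)
  ...     | l′ , ls , s≡ , _ , s , _ = inj₂ (inj₁ (absorb c (subst (λ x → Visited x c) (sym s≡) vis) s))
  step c | no ¬p | no ¬q with all? (λ x → visited? x c)
  ... | yes all = inj₁ (nothing-left (rest c) refl , all)
    where
    nothing-left : ∀ ls → rest c ≡ ls → ls ≡ []
    nothing-left []       _  = refl
    nothing-left (l ∷ ls) eq = contradiction (subst (Any _) (sym eq) (here (all (src l)))) ¬p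
  ... | no ¬all with ¬∀⟶∃¬ n (λ x → Visited x c) (λ x → visited? x c) ¬all
  ...   | w , ¬vis = inj₂ (grow c rest-unvisited ¬vis)
    where
    rest-unvisited : ∀ {l x} → l ∈ rest c → Touches x l → ¬ Visited x c
    rest-unvisited l∈ (inj₁ refl) vis = ¬p (Any.map (λ { refl → vis }) l∈)
    rest-unvisited l∈ (inj₂ refl) vis = ¬q (Any.map (λ { refl → vis }) l∈)

  -- Lexicographic induction: `a` bounds the edges still missing from the trail, `b` the unvisited
  -- vertices.
  complete : ∀ a b c → m ≤ length (trail c) + a → unvisited c ≤ b → ∃ Complete
  complete a b c le≤ un≤ with step c
  ... | inj₁ done = c , done
  complete zero    b       c le≤ un≤ | inj₂ (inj₁ (c′ , lt)) =
    contradiction (trail-length c′) (<⇒≱ (≤-<-trans (≤-trans le≤ (≤-reflexive (+-identityʳ _))) lt))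
  complete (suc a) b       c le≤ un≤ | inj₂ (inj₁ (c′ , lt)) =
    -- A longer trail may visit fewer vertices as far as the measure knows, so the second bound is
    -- reset.
    complete a (unvisited c′) c′ (≤-trans le≤ (≤-trans (≤-reflexive (+-suc _ a)) (+-monoˡ-≤ a lt))) ≤-refl
  complete a       zero    c le≤ un≤ | inj₂ (inj₂ (v , ¬vis , c′ , ext)) =
    contradiction (<-≤-trans (extends-unvisited ¬vis ext) un≤) λ ()
  complete a       (suc b) c le≤ un≤ | inj₂ (inj₂ (v , ¬vis , c′ , ext)) =
    complete a b c′ (subst (λ t → m ≤ t + a) (Extends.same-length ext) le≤)
      (s≤s⁻¹ (<-≤-trans (extends-unvisited ¬vis ext) un≤))

-- Correcting parities: an even choice of links.

unique⇒count≤1 : ∀ {n} {xs : List (Fin n)} → Unique xs → ∀ y → ∑ xs (λ x → 𝟙 (x ≟ y)) ≤ 1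
unique⇒count≤1 []                      y = z≤n
unique⇒count≤1 {xs = x ∷ xs} (x∉ ∷ uniq) y with x ≟ y
... | no _     = unique⇒count≤1 uniq y
... | yes refl = s≤s (≤-trans (∑-mono xs (λ {z} z∈ → ≤-reflexive (𝟙-no (z ≟ x) (λ z≡x → All.lookup x∉ z∈ (sym z≡x)))))
                              (≤-reflexive (∑-zero xs)))

unique⇒∑≤ : ∀ {n} {xs : List (Fin n)} → Unique xs → ∀ f → ∑ xs f ≤ ∑ (allFin n) f
unique⇒∑≤ {n} {xs} uniq f = begin
  ∑ xs f                                                ≡⟨ ∑-cong xs (λ x → ∑-δ x f) ⟨
  ∑ xs (λ x → ∑ (allFin n) (λ y → 𝟙 (x ≟ y) * f y))     ≡⟨ ∑-comm xs (allFin n) _ ⟩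
  ∑ (allFin n) (λ y → ∑ xs (λ x → 𝟙 (x ≟ y) * f y))     ≡⟨ ∑-cong (allFin n) (λ y → ∑-*ʳ xs (f y) _) ⟩
  ∑ (allFin n) (λ y → ∑ xs (λ x → 𝟙 (x ≟ y)) * f y)     ≤⟨ ∑-mono (allFin n) (λ {y} _ → *-monoˡ-≤ (f y) (unique⇒count≤1 uniq y)) ⟩
  ∑ (allFin n) (λ y → 1 * f y)                          ≡⟨ ∑-cong (allFin n) (λ y → *-identityˡ (f y)) ⟩
  ∑ (allFin n) f                                        ∎
  where open ≤-Reasoning

module Parity {n m : ℕ} (E : Hypergraph n m) (k : ℕ) (3≤size : ∀ e → 3 ≤ ∣ E e ∣)
  (size≤ : ∀ e → ∣ E e ∣ ≤ suc k) (codegree≥ : ∀ {u v} → u ≢ v → suc k ≤ codegree E u v) where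
  open Trails E
  open Growth E

  -- Count incidences between `us` and the edges through `v`: each `u` contributes at least `suc k`,
  -- each edge receives at most `suc k`. Fewer than `length us` edges cannot account for all of
  -- them.
  fresh-edge : ∀ {us v} {F G : List (Fin m)} → Unique us → All (_≢ v) us → length F < length us → F ++ G ↭ allFin m →
    ∃₂ λ e u → e ∈ G × u ∈ us × u ∈ₛ E e × v ∈ₛ E e
  fresh-edge {us} {v} {F} {G} uniq us≢v F<us F++G with ∑-pos⇒∃ G G-pos
    where
    hits : Fin m → ℕ
    hits e = ∑ us (λ u → 𝟙 (u ∈? E e) * 𝟙 (v ∈? E e))
    hits≤ : ∀ e → hits e ≤ suc k
    hits≤ e = begin
      hits e                          ≤⟨ ∑-mono us (λ {u} _ → ≤-trans
                                           (*-monoʳ-≤ (𝟙 (u ∈? E e)) (𝟙-≤1 (v ∈? E e))) (≤-reflexive (*-identityʳ _))) ⟩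
      ∑ us (λ u → 𝟙 (u ∈? E e))         ≤⟨ unique⇒∑≤ uniq _ ⟩
      ∑ (allFin n) (λ u → 𝟙 (u ∈? E e)) ≡⟨ ∑-∈ (E e) ⟩
      ∣ E e ∣                          ≤⟨ size≤ e ⟩
      suc k                           ∎
      where open ≤-Reasoning
    total : length us * suc k ≤ ∑ F hits + ∑ G hits
    total = begin
      length us * suc k               ≡⟨ ∑-const us (suc k) ⟨
      ∑ us (λ _ → suc k)              ≤⟨ ∑-mono us (λ u∈ → codegree≥ (All.lookup us≢v u∈)) ⟩
      ∑ us (λ u → codegree E u v)     ≡⟨ ∑-comm us (allFin m) _ ⟩
      ∑ (allFin m) hits               ≡⟨ ∑-↭ hits F++G ⟨
      ∑ (F ++ G) hits                 ≡⟨ ∑-++ F G hits ⟩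
      ∑ F hits + ∑ G hits             ∎
      where open ≤-Reasoning
    F-few : ∑ F hits < length us * suc k
    F-few = ≤-<-trans (≤-trans (∑-mono F (λ {e} _ → hits≤ e)) (≤-reflexive (∑-const F (suc k))))
                      (*-monoˡ-< (suc k) F<us)
    G-pos : 0 < ∑ G hits
    G-pos = +-cancelˡ-< (∑ F hits) 0 (∑ G hits)
      (subst (_< ∑ F hits + ∑ G hits) (sym (+-identityʳ _)) (<-≤-trans F-few total))
  ... | e , e∈ , p with ∑-pos⇒∃ us p
  ...   | u , u∈ , q with 0<*⇒ (𝟙 (u ∈? E e)) (𝟙 (v ∈? E e)) q
  ...     | a , b = e , u , e∈ , u∈ , 𝟙-pos⇒ (u ∈? E e) a , 𝟙-pos⇒ (v ∈? E e) b

  -- A tree of edges, each with a third vertex: choosing between its two links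
  -- at that vertex corrects the parity of the vertices of vs one by one.
  -- Outside root ∷ vs the parity does not depend on the choices.
  record Corrector (root : Fin n) (vs : List (Fin n)) : Set where
    field
      used spare : List (Fin m)
      few        : length used ≡ length vs
      all-edges  : used ++ spare ↭ allFin m
      base       : Fin n → Bool
      correct    : ∀ (t : Fin n → Bool) → ∃ λ ls → map edge ls ≡ used ×
        (∀ {x} → x ∈ vs → parity ls x ≡ t x) × (∀ {x} → x ∉ root ∷ vs → parity ls x ≡ base x)

  corrector : ∀ root vs → Unique (root ∷ vs) → Corrector root vs
  corrector root []       uniq = record
    { used = [] ; spare = allFin m ; few = refl ; all-edges = ↭-reflexive refl ; base = λ _ → false
    ; correct = λ _ → [] , refl , (λ ()) , λ _ → refl }
  corrector root (v ∷ vs) ((root≢v ∷ root∉) ∷ (v∉ ∷ uniq))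
    with corrector root vs (root∉ ∷ uniq)
  ... | T with fresh-edge {root ∷ vs} {v} {Corrector.used T} {Corrector.spare T} (root∉ ∷ uniq)
                 (root≢v ∷ All.map (_∘ sym) v∉) (s≤s (≤-reflexive (Corrector.few T))) (Corrector.all-edges T)
  ...   | e , u , e∈ , u∈ , u∈e , v∈e with ∈-∃++ e∈ | third∈ (E e) (3≤size e) u v
  ...     | as , bs , eq | z , z∈e , u≢z , v≢z = record
    { used      = e ∷ Corrector.used T
    ; spare     = as ++ bs
    ; few       = cong suc (Corrector.few T)
    ; all-edges = ↭-trans (↭-trans (↭-sym (shift e used (as ++ bs))) (↭ₚ.++⁺ˡ used (↭-sym (shift e as bs))))
                    (subst (λ s → used ++ s ↭ allFin m) eq (Corrector.all-edges T))
    -- Both possible links on `e` end at `z`, and their other ends lie in the enlarged tree.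
    ; base      = λ x → δ z x xor base x
    ; correct   = correct
    }
    where
    open Corrector T using (used; base)
    v∉tree : v ∉ root ∷ vs
    v∉tree (here v≡root) = root≢v (sym v≡root)
    v∉tree (there v∈vs)  = All.lookup v∉ v∈vs refl
    choice : Bool → Link
    choice true  = record { edge = e ; src = z ; tgt = v ; src∈ = z∈e ; tgt∈ = v∈e ; src≢tgt = v≢z ∘ sym }
    choice false = record { edge = e ; src = z ; tgt = u ; src∈ = z∈e ; tgt∈ = u∈e ; src≢tgt = u≢z ∘ sym }
    choice-edge : ∀ b → edge (choice b) ≡ e
    choice-edge true  = refl
    choice-edge false = refl
    choice-at-v : ∀ b → linkParity (choice b) v ≡ b
    choice-at-v true  = cong₂ _xor_ (δ-≢ (v≢z ∘ sym)) (δ-refl v)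
    choice-at-v false = cong₂ _xor_ (δ-≢ (v≢z ∘ sym)) (δ-≢ {a = u} {v} λ { refl → v∉tree u∈ })
    choice-outside : ∀ b {x} → x ∉ root ∷ v ∷ vs → linkParity (choice b) x ≡ δ z x
    choice-outside true  {x} x∉ = ≡.trans
      (cong (δ z x xor_) (δ-≢ {a = v} {x} λ { refl → x∉ (there (here refl)) })) (xor-identityʳ _)
    choice-outside false {x} x∉ = ≡.trans
      (cong (δ z x xor_) (δ-≢ {a = u} {x} λ { refl → x∉ (widen u∈) })) (xor-identityʳ _)
      where
      widen : ∀ {x} → x ∈ root ∷ vs → x ∈ root ∷ v ∷ vs
      widen (here p)  = here p
      widen (there p) = there (there p)
    correct : ∀ (t : Fin n → Bool) → ∃ λ ls → map edge ls ≡ e ∷ used ×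
      (∀ {x} → x ∈ v ∷ vs → parity ls x ≡ t x) × (∀ {x} → x ∉ root ∷ v ∷ vs → parity ls x ≡ δ z x xor base x)
    correct t with Corrector.correct T (λ x → linkParity (choice (t v xor base v)) x xor t x)
    ... | ls , edges , inside , outside = choice b ∷ ls , cong₂ _∷_ (choice-edge b) edges , inside′ , outside′
      where
      b = t v xor base v
      xor-cancelʳ : ∀ p q → (p xor q) xor q ≡ p
      xor-cancelʳ p q = ≡.trans (xor-assoc p q q) (≡.trans (cong (p xor_) (xor-same q)) (xor-identityʳ p))
      inside′ : ∀ {x} → x ∈ v ∷ vs → parity (choice b ∷ ls) x ≡ t x
      inside′ (here refl) = ≡.trans (cong₂ _xor_ (choice-at-v b) (outside v∉tree)) (xor-cancelʳ (t v) (base v))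
      inside′ {x} (there x∈) = ≡.trans (cong (linkParity (choice b) x xor_) (inside x∈))
        (≡.trans (sym (xor-assoc (linkParity (choice b) x) _ _)) (cong (_xor t x) (xor-same (linkParity (choice b) x))))
      outside′ : ∀ {x} → x ∉ root ∷ v ∷ vs → parity (choice b ∷ ls) x ≡ δ z x xor base x
      outside′ x∉ = cong₂ _xor_ (choice-outside b x∉) (outside λ
        { (here p) → x∉ (here p) ; (there p) → x∉ (there (there p)) })

  some-links : Fin n → ∀ es → ∃ λ ls → map edge ls ≡ es
  some-links v []       = [] , refl
  some-links v (e ∷ es) with some-links v es | third∈ (E e) (3≤size e) v v
  -- Called with equal arguments, `third∈` gives a second vertex different from `a`.
  ... | ls , eq | a , a∈ , _ with third∈ (E e) (3≤size e) a a
  ...   | b , b∈ , a≢b , _ =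
    record { edge = e ; src = a ; tgt = b ; src∈ = a∈ ; tgt∈ = b∈ ; src≢tgt = a≢b } ∷ ls , cong (e ∷_) eq

-- The spare edges get arbitrary links, and the tree edges are chosen to cancel their parity off the
-- root. The root is then even by `no-single-odd`.
initial : ∀ {n m} (E : Hypergraph (suc n) m) k → (∀ e → 3 ≤ ∣ E e ∣) → (∀ e → ∣ E e ∣ ≤ suc k) →
  (∀ {u v} → u ≢ v → suc k ≤ codegree E u v) → Growth.Config E
initial {n} {m} E k 3≤size size≤ codegree≥ = record
  { root = fzero ; trail = [] ; rest = links ; closed = refl ; even = even-links
  ; covers = subst (_↭ allFin m) (sym (≡.trans (map-++ edge chosen free) (cong₂ _++_ chosen-edges free-edges))) all-edges }
  where
  open Trails E
  open Parity E k 3≤size size≤ codegree≥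
  open Corrector (corrector fzero (tabulate fsuc) (allFin⁺ (suc n)))
  free = proj₁ (some-links fzero spare)
  free-edges = proj₂ (some-links fzero spare)
  corrected = correct (parity free)
  chosen = proj₁ corrected
  chosen-edges = proj₁ (proj₂ corrected)
  links = chosen ++ free
  even-off-root : ∀ x → parity links (fsuc x) ≡ false
  even-off-root x = ≡.trans (parity-++ chosen free (fsuc x))
    (≡.trans (cong (_xor parity free (fsuc x)) (proj₁ (proj₂ (proj₂ corrected)) (∈-tabulate⁺ {f = fsuc} x)))
      (xor-same (parity free (fsuc x))))
  even-links : Even links
  even-links (fsuc x) = even-off-root x
  even-links fzero with parity links fzero in eq
  ... | false = refl
  ... | true  = contradiction only-root (no-single-odd (length links) links refl fzero)
    where
    only-root : ∀ x → parity links x ≡ δ fzero x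
    only-root fzero    = eq
    only-root (fsuc x) = even-off-root x

-- Reading an Euler tour off a complete closed trail.

next-spec : ∀ {m} (i : Fin m) → toℕ (next i) ≡ suc (toℕ i) ⊎ (suc (toℕ i) ≡ m × toℕ (next i) ≡ 0)
next-spec {suc m} i with suc (toℕ i) <? suc m
... | yes p = inj₁ (toℕ-fromℕ< p)
... | no ¬p = inj₂ (≤-antisym (toℕ<n i) (≮⇒≥ ¬p) , refl)

unique-map-lookup : ∀ {A B : Set} {f : A → B} {xs : List A} → Unique (map f xs) →
  ∀ i j → f (lookup xs i) ≡ f (lookup xs j) → i ≡ j
unique-map-lookup {xs = x ∷ xs} _         fzero    fzero    _  = refl
unique-map-lookup {f = f} {x ∷ xs} (x∉ ∷ _) fzero (fsuc j) eq = contradiction eq (All.lookup x∉ (∈-map⁺ f (∈-lookup j)))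
unique-map-lookup {f = f} {x ∷ xs} (x∉ ∷ _) (fsuc i) fzero eq = contradiction (sym eq) (All.lookup x∉ (∈-map⁺ f (∈-lookup i)))
unique-map-lookup {xs = x ∷ xs} (_ ∷ uniq) (fsuc i) (fsuc j) eq = cong fsuc (unique-map-lookup uniq i j eq)

module Tour {n m : ℕ} (E : Hypergraph n m) where
  open Trails E
  open Growth E

  chain-next : ∀ {x y} ls → Chain x ls y → ∀ i j → toℕ j ≡ suc (toℕ i) → src (lookup ls j) ≡ tgt (lookup ls i)
  chain-next (l ∷ k ∷ ls) (_ , p , _) fzero    (fsuc fzero) _  = p
  chain-next (l ∷ ls)     (_ , c)     (fsuc i) (fsuc j)     eq = chain-next ls c i j (suc-injective eq)
  chain-next (l ∷ k ∷ ls) _           fzero    (fsuc (fsuc j)) ()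

  chain-first : ∀ {x y} ls → Chain x ls y → ∀ j → toℕ j ≡ 0 → src (lookup ls j) ≡ x
  chain-first (l ∷ ls) (p , _) fzero _ = p

  chain-last : ∀ {x y} ls → Chain x ls y → ∀ i → suc (toℕ i) ≡ length ls → tgt (lookup ls i) ≡ y
  chain-last (l ∷ [])     (_ , p) fzero    _  = p
  chain-last (l ∷ k ∷ ls) (_ , c) (fsuc i) eq = chain-last (k ∷ ls) c i (suc-injective eq)

  -- The tour lists the sources of the links; each target is the next source, cyclically because the
  -- trail is closed.
  tour : 0 < m → ∀ c → rest c ≡ [] → (∀ x → Visited x c) → HasSpanningEulerTour E
  tour 0<m c rest≡[] all-visited = record
    { vert     = src ∘ at
    ; edge     = edge ∘ at
    ; edge-bij = injective , surjective
    ; inc₁     = src∈ ∘ at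
    ; inc₂     = λ i → subst (_∈ₛ E (edge (at i))) (sym (follows i)) (tgt∈ (at i))
    ; distinct = λ i eq → src≢tgt (at i) (≡.trans eq (follows i))
    } , λ v → spanning v
    where
    edges-↭ : map edge (trail c) ↭ allFin m
    edges-↭ = subst (λ t → map edge t ↭ allFin m)
      (≡.trans (cong (trail c ++_) rest≡[]) (++-identityʳ (trail c))) (covers c)
    length-m : m ≡ length (trail c)
    length-m = ≡.trans (sym (length-tabulate id)) (≡.trans (↭-length (↭-sym edges-↭)) (length-map edge (trail c)))
    at : Fin m → Link
    at i = lookup (trail c) (cast length-m i)
    at-cast : ∀ j → at (cast (sym length-m) j) ≡ lookup (trail c) j
    at-cast j = cong (lookup (trail c)) (toℕ-injective
      (≡.trans (toℕ-cast length-m (cast (sym length-m) j)) (toℕ-cast (sym length-m) j)))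
    cast-injective : ∀ {i j : Fin m} → cast length-m i ≡ cast length-m j → i ≡ j
    cast-injective {i} {j} eq = toℕ-injective (≡.trans (sym (toℕ-cast length-m i)) (≡.trans (cong toℕ eq) (toℕ-cast length-m j)))
    injective : ∀ {i j} → edge (at i) ≡ edge (at j) → i ≡ j
    injective eq = cast-injective (unique-map-lookup
      (↭ₛ.Unique-resp-↭ (≡.setoid (Fin m)) (↭⇒↭ₛ (↭-sym edges-↭)) (allFin⁺ m)) _ _ eq)
    from-∈ : ∀ {l} → l ∈ trail c → ∃ λ i → at i ≡ l
    from-∈ l∈ = cast (sym length-m) (Any.index l∈) , ≡.trans (at-cast (Any.index l∈)) (sym (lookup-index l∈))
    surjective : ∀ e → ∃ λ i → ∀ {j} → j ≡ i → edge (at j) ≡ e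
    surjective e with ∈-map⁻ edge (∈-resp-↭ (↭-sym edges-↭) (∈-allFin e))
    ... | l , l∈ , e≡ with from-∈ l∈
    ...   | i , at≡ = i , λ { refl → ≡.trans (cong edge at≡) (sym e≡) }
    follows : ∀ i → src (at (next i)) ≡ tgt (at i)
    follows i with next-spec i
    ... | inj₁ eq = chain-next (trail c) (closed c) _ _
          (≡.trans (toℕ-cast length-m (next i)) (≡.trans eq (cong suc (sym (toℕ-cast length-m i)))))
    ... | inj₂ (last , first) = ≡.trans
          (chain-first (trail c) (closed c) _ (≡.trans (toℕ-cast length-m (next i)) first))
          (sym (chain-last (trail c) (closed c) _ (≡.trans (cong suc (toℕ-cast length-m i)) (≡.trans last length-m))))
    first-link : ∀ {x y} ls → 0 < length ls → Chain x ls y → ∃ λ l → l ∈ ls × src l ≡ x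
    first-link (l ∷ ls) _ (p , _) = l , here refl , p
    leaving : ∀ v → ∃ λ l → l ∈ trail c × src l ≡ v
    leaving v with chain-cut (trail c) (closed c) (all-visited v)
    ... | as , l ∷ bs , eq , _ , (p , _) = l , subst (l ∈_) (sym eq) (∈-++⁺ʳ as (here refl)) , p
    -- A cut at the very end means that `v` is the root, which the first link leaves.
    ... | as , []     , eq , _ , refl    = first-link (trail c) (subst (0 <_) length-m 0<m) (closed c)
    spanning : ∀ v → ∃ λ i → src (at i) ≡ v
    spanning v with leaving v
    ... | l , l∈ , p with from-∈ l∈
    ...   | i , at≡ = i , ≡.trans (cong src at≡) p

-- Reducing the degree conditions to degrees of pairs.

deg-∑ : ∀ {n m} (E : Hypergraph n m) T → deg E T ≡ ∑ (allFin m) (λ e → 𝟙 (T ⊆? E e))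
deg-∑ {m = m} E T = ∑-filter (λ e → T ⊆? E e) (allFin m)

∣p∪⁅x⁆∣ : ∀ {n t} (p : Subset n) x → ¬ (x ∈ₛ p) → ∣ p ∣ ≡ t → ∣ p ∪ ⁅ x ⁆ ∣ ≡ suc t
∣p∪⁅x⁆∣ {n} {t} p x x∉p ∣p∣ = begin
  ∣ p ∪ ⁅ x ⁆ ∣                                ≡⟨ ∑-∈ (p ∪ ⁅ x ⁆) ⟨
  ∑ (allFin n) (λ y → 𝟙 (y ∈? p ∪ ⁅ x ⁆))      ≡⟨ ∑-cong (allFin n) pointwise ⟩
  ∑ (allFin n) (λ y → 𝟙 (x ≟ y) + 𝟙 (y ∈? p))  ≡⟨ ∑-+ (allFin n) _ _ ⟩
  ∑ (allFin n) (λ y → 𝟙 (x ≟ y)) + ∑ (allFin n) (λ y → 𝟙 (y ∈? p)) ≡⟨ cong₂ _+_ (∑-δ₁ x) (≡.trans (∑-∈ p) ∣p∣) ⟩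
  suc t                                        ∎
  where
  open ≡.≡-Reasoning
  pointwise : ∀ y → 𝟙 (y ∈? p ∪ ⁅ x ⁆) ≡ 𝟙 (x ≟ y) + 𝟙 (y ∈? p)
  pointwise y with x ≟ y | y ∈? p
  ... | yes refl | yes x∈p = contradiction x∈p x∉p
  ... | yes refl | no _    = 𝟙-yes (x ∈? p ∪ ⁅ x ⁆) (x∈p∪q⁺ (inj₂ (x∈⁅x⁆ x)))
  ... | no _     | yes y∈p = 𝟙-yes (y ∈? p ∪ ⁅ x ⁆) (x∈p∪q⁺ (inj₁ y∈p))
  ... | no x≢y   | no y∉p  = 𝟙-no (y ∈? p ∪ ⁅ x ⁆) λ y∈ → case (x∈p∪q⁻ p ⁅ x ⁆ y∈)
    where
    case : y ∈ₛ p ⊎ y ∈ₛ ⁅ x ⁆ → _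
    case (inj₁ y∈p) = y∉p y∈p
    case (inj₂ y∈x) = x≢y (sym (x∈⁅y⁆⇒x≡y x y∈x))

minDeg⇒codegree : ∀ {n m} (E : Hypergraph n m) {d} → MinDegGE E 2 d → ∀ {u v} → u ≢ v → d ≤ codegree E u v
minDeg⇒codegree {m = m} E δ₂ {u} {v} u≢v = begin
  _                                          ≤⟨ δ₂ T (∣p∪⁅x⁆∣ ⁅ u ⁆ v (λ v∈ → u≢v (sym (x∈⁅y⁆⇒x≡y u v∈))) (∣⁅x⁆∣≡1 u)) ⟩
  deg E T                                    ≡⟨ deg-∑ E T ⟩
  ∑ (allFin m) (λ e → 𝟙 (T ⊆? E e))          ≤⟨ ∑-mono (allFin m) (λ {e} _ → pointwise e) ⟩
  codegree E u v                             ∎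
  where
  open ≤-Reasoning
  T = ⁅ u ⁆ ∪ ⁅ v ⁆
  pointwise : ∀ e → 𝟙 (T ⊆? E e) ≤ 𝟙 (u ∈? E e) * 𝟙 (v ∈? E e)
  pointwise e with T ⊆? E e
  ... | no _    = z≤n
  ... | yes T⊆e = ≤-reflexive (sym (cong₂ _*_
        (𝟙-yes (u ∈? E e) (T⊆e (x∈p∪q⁺ (inj₁ (x∈⁅x⁆ u))))) (𝟙-yes (v ∈? E e) (T⊆e (x∈p∪q⁺ (inj₂ (x∈⁅x⁆ v)))))))

-- Count pairs of a vertex x outside `T` and an edge containing `T` and x: each of the n - t
-- vertices gives at least `d`, each edge over `T` at most k - t.
minDeg-descent : ∀ {n m} (E : Hypergraph n m) {k t d} → (∀ e → ∣ E e ∣ ≤ k) → MinDegGE E (suc t) d →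
  ∀ T → ∣ T ∣ ≡ t → d * (n ∸ t) ≤ deg E T * (k ∸ t)
minDeg-descent {n} {m} E {k} {t} {d} size≤ δₜ₊₁ T ∣T∣ = begin
  d * (n ∸ t)                                             ≡⟨ cong (d *_) outside ⟨
  d * ∑ (allFin n) out                                    ≡⟨ ∑-*ˡ (allFin n) d out ⟨
  ∑ (allFin n) (λ x → d * out x)                          ≤⟨ ∑-mono (allFin n) (λ {x} _ → extend x) ⟩
  ∑ (allFin n) (λ x → ∑ (allFin m) (λ e → 𝟙 (T ⊆? E e) * (out x * 𝟙 (x ∈? E e))))
    ≡⟨ ∑-comm (allFin n) (allFin m) _ ⟩
  ∑ (allFin m) (λ e → ∑ (allFin n) (λ x → 𝟙 (T ⊆? E e) * (out x * 𝟙 (x ∈? E e))))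
    ≡⟨ ∑-cong (allFin m) (λ e → ∑-*ˡ (allFin n) (𝟙 (T ⊆? E e)) (λ x → out x * 𝟙 (x ∈? E e))) ⟩
  ∑ (allFin m) (λ e → 𝟙 (T ⊆? E e) * ∑ (allFin n) (λ x → out x * 𝟙 (x ∈? E e)))
    ≤⟨ ∑-mono (allFin m) (λ {e} _ → leftover e) ⟩
  ∑ (allFin m) (λ e → 𝟙 (T ⊆? E e) * (k ∸ t))             ≡⟨ ∑-*ʳ (allFin m) (k ∸ t) _ ⟩
  ∑ (allFin m) (λ e → 𝟙 (T ⊆? E e)) * (k ∸ t)             ≡⟨ cong (_* (k ∸ t)) (deg-∑ E T) ⟨
  deg E T * (k ∸ t)                                       ∎
  where
  open ≤-Reasoning
  out : Fin n → ℕ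
  out x = 𝟙 (¬? (x ∈? T))
  outside : ∑ (allFin n) out ≡ n ∸ t
  outside = ≡.trans (sym (m+n∸n≡m (∑ (allFin n) out) t)) (cong (_∸ t) (begin-equality
    ∑ (allFin n) out + t                               ≡⟨ cong (∑ (allFin n) out +_) (≡.trans (∑-∈ T) ∣T∣) ⟨
    ∑ (allFin n) out + ∑ (allFin n) (λ x → 𝟙 (x ∈? T)) ≡⟨ ∑-+ (allFin n) out _ ⟨
    ∑ (allFin n) (λ x → out x + 𝟙 (x ∈? T))            ≡⟨ ∑-cong (allFin n) complement ⟩
    ∑ (allFin n) (λ _ → 1)                             ≡⟨ ∑-const (allFin n) 1 ⟩
    length (allFin n) * 1                              ≡⟨ *-identityʳ _ ⟩
    length (allFin n)                                  ≡⟨ length-tabulate id ⟩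
    n                                                  ∎))
    where
    complement : ∀ x → out x + 𝟙 (x ∈? T) ≡ 1
    complement x with x ∈? T
    ... | yes _ = refl
    ... | no _  = refl
  extend : ∀ x → d * out x ≤ ∑ (allFin m) (λ e → 𝟙 (T ⊆? E e) * (out x * 𝟙 (x ∈? E e)))
  extend x with x ∈? T
  ... | yes _  = ≤-trans (≤-reflexive (*-zeroʳ d)) z≤n
  ... | no x∉T = begin
    d * 1                                                         ≡⟨ *-identityʳ d ⟩
    d                                                             ≤⟨ δₜ₊₁ (T ∪ ⁅ x ⁆) (∣p∪⁅x⁆∣ T x x∉T ∣T∣) ⟩
    deg E (T ∪ ⁅ x ⁆)                                             ≡⟨ deg-∑ E (T ∪ ⁅ x ⁆) ⟩
    ∑ (allFin m) (λ e → 𝟙 (T ∪ ⁅ x ⁆ ⊆? E e))                     ≤⟨ ∑-mono (allFin m) (λ {e} _ → pointwise e) ⟩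
    ∑ (allFin m) (λ e → 𝟙 (T ⊆? E e) * (1 * 𝟙 (x ∈? E e)))        ∎
    where
    pointwise : ∀ e → 𝟙 (T ∪ ⁅ x ⁆ ⊆? E e) ≤ 𝟙 (T ⊆? E e) * (1 * 𝟙 (x ∈? E e))
    pointwise e with T ∪ ⁅ x ⁆ ⊆? E e
    ... | no _  = z≤n
    ... | yes s = ≤-reflexive (sym (cong₂ _*_ (𝟙-yes (T ⊆? E e) (λ y∈ → s (x∈p∪q⁺ (inj₁ y∈))))
                    (cong (1 *_) (𝟙-yes (x ∈? E e) (s (x∈p∪q⁺ (inj₂ (x∈⁅x⁆ x))))))))
  leftover : ∀ e → 𝟙 (T ⊆? E e) * ∑ (allFin n) (λ x → out x * 𝟙 (x ∈? E e)) ≤ 𝟙 (T ⊆? E e) * (k ∸ t)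
  leftover e with T ⊆? E e
  ... | no _    = z≤n
  ... | yes T⊆e = *-monoʳ-≤ 1 (begin
    ∑ (allFin n) inside                        ≡⟨ m+n∸n≡m _ t ⟨
    ∑ (allFin n) inside + t ∸ t                ≡⟨ cong (λ s → ∑ (allFin n) inside + s ∸ t) (≡.trans (∑-∈ T) ∣T∣) ⟨
    ∑ (allFin n) inside + ∑ (allFin n) (λ x → 𝟙 (x ∈? T)) ∸ t ≡⟨ cong (_∸ t) (∑-+ (allFin n) inside _) ⟨
    ∑ (allFin n) (λ x → inside x + 𝟙 (x ∈? T)) ∸ t ≤⟨ ∸-monoˡ-≤ t (∑-mono (allFin n) (λ {x} _ → pointwise x)) ⟩
    ∑ (allFin n) (λ x → 𝟙 (x ∈? E e)) ∸ t      ≡⟨ cong (_∸ t) (∑-∈ (E e)) ⟩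
    ∣ E e ∣ ∸ t                                ≤⟨ ∸-monoˡ-≤ t (size≤ e) ⟩
    k ∸ t                                      ∎)
    where
    inside : Fin n → ℕ
    inside x = out x * 𝟙 (x ∈? E e)
    pointwise : ∀ x → inside x + 𝟙 (x ∈? T) ≤ 𝟙 (x ∈? E e)
    pointwise x with x ∈? T
    ... | yes x∈T = ≤-reflexive (sym (𝟙-yes (x ∈? E e) (T⊆e x∈T)))
    ... | no _    = ≤-reflexive (≡.trans (+-identityʳ _) (+-identityʳ _))

minDeg-down : ∀ {n m} (E : Hypergraph n m) {k t} → (∀ e → ∣ E e ∣ ≤ k) → t < n → MinDegGE E (suc t) 1 → MinDegGE E t 1
minDeg-down E {k} {t} size≤ t<n δ T ∣T∣ = pos (deg E T) (minDeg-descent E size≤ δ T ∣T∣)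
  where
  pos : ∀ d → 1 * (_ ∸ t) ≤ d * (k ∸ t) → 1 ≤ d
  pos zero    le = contradiction (≤-trans (m<n⇒0<n∸m t<n) (≤-trans (≤-reflexive (sym (+-identityʳ _))) le)) λ ()
  pos (suc d) _  = s≤s z≤n

minDeg-down-to-4 : ∀ {n m} (E : Hypergraph n m) {k} i → (∀ e → ∣ E e ∣ ≤ k) → i + 4 ≤ n → MinDegGE E (i + 4) 1 → MinDegGE E 4 1
minDeg-down-to-4 E zero    size≤ le δ = δ
minDeg-down-to-4 E (suc i) size≤ le δ = minDeg-down-to-4 E i size≤ (<⇒≤ le) (minDeg-down E size≤ le δ)

-- A pair of degree at most k - 1 would give n - 2 ≤ (k - 1)(k - 2), that is n ≤ k^2 - 3k + 4, one
-- below the assumed bound.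
minDeg₃⇒minDeg₂ : ∀ {n m} (E : Hypergraph n m) {k} → 3 ≤ k → (∀ e → ∣ E e ∣ ≤ k) → k * k + 5 ≤ n + 3 * k →
  MinDegGE E 3 1 → MinDegGE E 2 k
minDeg₃⇒minDeg₂ {n} E {suc (suc j)} 3≤k size≤ big δ₃ T ∣T∣ = ≮⇒≥ λ D<k → <-irrefl refl (begin-strict
  k * k + 5                 ≤⟨ big ⟩
  n + 3 * k                 ≤⟨ +-monoˡ-≤ (3 * k) (m≤n+m∸n n 2) ⟩
  2 + (n ∸ 2) + 3 * k       ≤⟨ +-monoˡ-≤ (3 * k) (+-monoʳ-≤ 2 (≤-trans (≤-reflexive (sym (*-identityˡ (n ∸ 2))))
                                 (≤-trans (minDeg-descent E size≤ δ₃ T ∣T∣) (*-monoˡ-≤ j (s≤s⁻¹ D<k))))) ⟩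
  2 + suc j * j + 3 * k     <⟨ ≤-reflexive (solve 1 (λ j → con 1 :+ (con 2 :+ (con 1 :+ j) :* j :+ con 3 :* (con 2 :+ j))
                                 := (con 2 :+ j) :* (con 2 :+ j) :+ con 5) refl j) ⟩
  k * k + 5                 ∎)
  where
  open ≤-Reasoning
  open +-*-Solver
  k = suc (suc j)
minDeg₃⇒minDeg₂ E {zero}        () _ _ _
minDeg₃⇒minDeg₂ E {suc zero}    (s≤s ()) _ _ _

-- Two descents. As n > k, a triple cannot have degree 1, so it has degree at least 2. Then a pair
-- of degree D satisfies D(k - 2) ≥ 2(n - 2) ≥ (k + 1)(k - 2).
minDeg₄⇒minDeg₂ : ∀ {n m} (E : Hypergraph n m) {k} → 4 ≤ k → (∀ e → ∣ E e ∣ ≤ k) → k * (k ∸ 1) + 2 ≤ 2 * n →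
  MinDegGE E 4 1 → MinDegGE E 2 k
minDeg₄⇒minDeg₂ {n} E {suc (suc (suc (suc i)))} _ size≤ big δ₄ T ∣T∣ =
  ≤-trans (m≤n+m k 1) (*-cancelʳ-≤ (suc k) (deg E T) j (begin
    suc k * j                 ≡⟨ m+n∸n≡m (suc k * j) 4 ⟨
    suc k * j + 4 ∸ 4         ≡⟨ cong (_∸ 4) (solve 1 (λ i → (con 5 :+ i) :* (con 2 :+ i) :+ con 4
                                   := (con 4 :+ i) :* (con 3 :+ i) :+ con 2) refl i) ⟩
    k * (k ∸ 1) + 2 ∸ 4       ≤⟨ ∸-monoˡ-≤ 4 big ⟩
    2 * n ∸ 4                 ≡⟨ *-distribˡ-∸ 2 n 2 ⟨
    2 * (n ∸ 2)               ≤⟨ minDeg-descent E size≤ δ₃ T ∣T∣ ⟩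
    deg E T * j               ∎))
  where
  open ≤-Reasoning
  open +-*-Solver
  k = 4 + i
  j = 2 + i
  k<n : k < n
  k<n = *-cancelˡ-≤ 2 (begin
    2 * suc k                                       ≤⟨ m≤m+n _ (4 + 5 * i + i * i) ⟩
    2 * suc k + (4 + 5 * i + i * i)                 ≡⟨ solve 1 (λ i → con 2 :* (con 5 :+ i) :+ (con 4 :+ con 5 :* i :+ i :* i)
                                                         := (con 4 :+ i) :* (con 3 :+ i) :+ con 2) refl i ⟩
    k * (k ∸ 1) + 2                                 ≤⟨ big ⟩
    2 * n                                           ∎)
  δ₃ : MinDegGE E 3 2
  δ₃ S ∣S∣ = ≮⇒≥ λ D<2 → <-irrefl refl (begin-strict
    k ∸ 3                     <⟨ ∸-monoˡ-< k<n (s≤s (s≤s (s≤s z≤n))) ⟩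
    n ∸ 3                     ≡⟨ *-identityˡ (n ∸ 3) ⟨
    1 * (n ∸ 3)               ≤⟨ minDeg-descent E size≤ δ₄ S ∣S∣ ⟩
    deg E S * (k ∸ 3)         ≤⟨ *-monoˡ-≤ (k ∸ 3) (s≤s⁻¹ D<2) ⟩
    1 * (k ∸ 3)               ≡⟨ *-identityˡ (k ∸ 3) ⟩
    k ∸ 3                     ∎)
minDeg₄⇒minDeg₂ E {zero}                 () _ _ _
minDeg₄⇒minDeg₂ E {suc zero}             (s≤s ()) _ _ _
minDeg₄⇒minDeg₂ E {suc (suc zero)}       (s≤s (s≤s ())) _ _ _
minDeg₄⇒minDeg₂ E {suc (suc (suc zero))} (s≤s (s≤s (s≤s ()))) _ _ _

-- The bound n ≥ C(k,2) + 1 from admissibility, doubled to avoid division.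

2*nC2 : ∀ n → 2 * (n C 2) ≡ n * (n ∸ 1)
2*nC2 zero    = refl
2*nC2 (suc n) = begin
  2 * (suc n C 2)          ≡⟨ cong (2 *_) (nCk+nC[k+1]≡[n+1]C[k+1] n 1) ⟨
  2 * (n C 1 + n C 2)      ≡⟨ *-distribˡ-+ 2 (n C 1) (n C 2) ⟩
  2 * (n C 1) + 2 * (n C 2) ≡⟨ cong₂ _+_ (cong (2 *_) (nC1≡n n)) (2*nC2 n) ⟩
  2 * n + n * (n ∸ 1)      ≡⟨ pred-form n ⟩
  suc n * n                ∎
  where
  open ≡.≡-Reasoning
  pred-form : ∀ n → 2 * n + n * (n ∸ 1) ≡ suc n * n
  pred-form zero    = refl
  pred-form (suc n) = solve 1 (λ n → con 2 :* (con 1 :+ n) :+ (con 1 :+ n) :* n := (con 2 :+ n) :* (con 1 :+ n)) refl n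
    where open +-*-Solver

nC2+1≤⇒ : ∀ k {n} → (k C 2) + 1 ≤ n → k * (k ∸ 1) + 2 ≤ 2 * n
nC2+1≤⇒ k le = ≤-trans
  (≤-reflexive (≡.trans (cong (_+ 2) (sym (2*nC2 k))) (sym (*-distribˡ-+ 2 (k C 2) 1)))) (*-monoʳ-≤ 2 le)

-- The case 2c - 1 ≤ k ≤ 2c of AboveG, with c = 2 + d.
middle-binomial : ∀ {n k} d → 3 + 2 * d ≤ k → k ≤ 4 + 2 * d →
  4 * (2 + d) * (2 + d) + (k ∸ 1) * (k ∸ 2) ≤ n * (4 * (2 + d) + 2 ∸ 2 * k) → k * (k ∸ 1) + 2 ≤ 2 * n
middle-binomial {n} {k} d ≤k k≤ le with m≤n⇒m<n∨m≡n k≤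
-- Here k = 2c: the factor of n is 2, and 4c^2 = k^2 alone suffices.
... | inj₂ refl = begin
  k * (k ∸ 1) + 2                            ≤⟨ m≤m+n _ (2 + 2 * d) ⟩
  k * (k ∸ 1) + 2 + (2 + 2 * d)              ≡⟨ solve 1 (λ d →
                                                    (con 4 :+ con 2 :* d) :* (con 3 :+ con 2 :* d) :+ con 2 :+ (con 2 :+ con 2 :* d)
                                                  := con 4 :* (con 2 :+ d) :* (con 2 :+ d)) refl d ⟩
  4 * (2 + d) * (2 + d)                      ≤⟨ m≤m+n _ _ ⟩
  4 * (2 + d) * (2 + d) + (k ∸ 1) * (k ∸ 2)  ≤⟨ le ⟩
  n * (4 * (2 + d) + 2 ∸ 2 * k)              ≡⟨ cong (n *_) (≡.trans (cong (_∸ 2 * k) (solve 1 (λ d →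
                                                    con 4 :* (con 2 :+ d) :+ con 2
                                                  := con 2 :* (con 4 :+ con 2 :* d) :+ con 2) refl d)) (m+n∸m≡n (2 * k) 2)) ⟩
  n * 2                                      ≡⟨ *-comm n 2 ⟩
  2 * n                                      ∎
  where
  open ≤-Reasoning
  open +-*-Solver
... | inj₁ k< with ≤-antisym ≤k (s≤s⁻¹ k<)
-- Here k = 2c - 1, and the factor of n is 4.
...   | refl = *-cancelˡ-≤ 2 (begin
  2 * (k * (k ∸ 1) + 2)                      ≤⟨ m≤m+n _ (2 * d + 2) ⟩
  2 * (k * (k ∸ 1) + 2) + (2 * d + 2)        ≡⟨ solve 1 (λ d →
                                                    con 2 :* ((con 3 :+ con 2 :* d) :* (con 2 :+ con 2 :* d) :+ con 2) :+ (con 2 :* d :+ con 2)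
                                                  := con 4 :* (con 2 :+ d) :* (con 2 :+ d)
                                                    :+ (con 2 :+ con 2 :* d) :* (con 1 :+ con 2 :* d)) refl d ⟩
  4 * (2 + d) * (2 + d) + (k ∸ 1) * (k ∸ 2)  ≤⟨ le ⟩
  n * (4 * (2 + d) + 2 ∸ 2 * k)              ≡⟨ cong (n *_) (≡.trans (cong (_∸ 2 * k) (solve 1 (λ d →
                                                    con 4 :* (con 2 :+ d) :+ con 2
                                                  := con 2 :* (con 3 :+ con 2 :* d) :+ con 4) refl d)) (m+n∸m≡n (2 * k) 4)) ⟩
  n * 4                                      ≡⟨ *-comm n 4 ⟩
  4 * n                                      ≡⟨ *-assoc 2 2 n ⟩
  2 * (2 * n)                                ∎)
  where
  open ≤-Reasoning
  open +-*-Solver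

aboveG⇒binomial : ∀ {n c k μ} → 3 ≤ c → 4 ≤ k → AboveG n c k μ → k * (k ∸ 1) + 2 ≤ 2 * n
aboveG⇒binomial {n} {c} {k} 3≤c 4≤k (_ , g₄ , g-small , g-middle , g-large)
  with k ≤? 2 * c ∸ 2 | k ≤? 2 * c | 4 ≤? c
... | yes k≤ | _ | yes 4≤c = nC2+1≤⇒ k (g-small 4≤c k≤)
... | yes k≤ | _ | no c<4 with ≤-antisym (s≤s⁻¹ (≰⇒> c<4)) 3≤c
...   | refl with ≤-antisym k≤ 4≤k
-- Only c = 3, k = 4 is left, where 14 is required and n ≥ 10 gives 20.
...     | refl = ≤-trans (m≤m+n 14 6) (*-monoʳ-≤ 2 (g₄ refl refl))
aboveG⇒binomial {n} {c} {k} 3≤c 4≤k (_ , _ , _ , _ , g-large) | no _ | no k≰ | _ =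
  nC2+1≤⇒ k (≤-trans (+-monoˡ-≤ 1 (m≤n+m (k C 2) _)) (g-large 3≤c (≰⇒> k≰)))
aboveG⇒binomial {n} {c} {k} 3≤c 4≤k (_ , _ , _ , g-middle , _) | no k≰ | yes k≤ | _ =
  middle c 3≤c (≰⇒> k≰) k≤ (g-middle 3≤c (≤-trans (pred≤ (2 * c)) (≰⇒> k≰)) k≤)
  where
  pred≤ : ∀ x → x ∸ 1 ≤ suc (x ∸ 2)
  pred≤ zero          = z≤n
  pred≤ (suc zero)    = z≤n
  pred≤ (suc (suc x)) = ≤-refl
  middle : ∀ c → 3 ≤ c → 2 * c ∸ 2 < k → k ≤ 2 * c →
    4 * c * c + (k ∸ 1) * (k ∸ 2) ≤ n * (4 * c + 2 ∸ 2 * k) → k * (k ∸ 1) + 2 ≤ 2 * n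
  middle (suc zero)    (s≤s ()) _ _ _
  middle (suc (suc d)) _ k> k≤ = middle-binomial {n} d (subst (λ t → t ∸ 2 < k) double k>) (subst (k ≤_) double k≤)
    where
    double : 2 * (2 + d) ≡ 4 + 2 * d
    double = *-distribˡ-+ 2 2 d

-- Assembling the theorem from the pair-degree case.

minDeg₂⇒spanningTour : ∀ {n m} (E : Hypergraph n m) {k} → (∀ e → 3 ≤ ∣ E e ∣) → (∀ e → ∣ E e ∣ ≤ k) → Fin m →
  MinDegGE E 2 k → HasSpanningEulerTour E
minDeg₂⇒spanningTour {zero}  E 3≤size size≤ e δ₂ = contradiction (≤-trans (3≤size e) (∣p∣≤n (E e))) λ ()
minDeg₂⇒spanningTour {suc n} E {zero}  3≤size size≤ e δ₂ = contradiction (≤-trans (3≤size e) (size≤ e)) λ ()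
minDeg₂⇒spanningTour {suc n} {suc m} E {suc k} 3≤size size≤ e δ₂
  with Progress.complete E k size≤ codegree≥ (suc m) (Progress.unvisited E k size≤ codegree≥ start) start ≤-refl ≤-refl
  where
  codegree≥ : ∀ {u v} → u ≢ v → suc k ≤ codegree E u v
  codegree≥ = minDeg⇒codegree E δ₂
  start = initial E k 3≤size size≤ codegree≥
... | c , rest≡[] , all-visited = Tour.tour E (s≤s z≤n) c rest≡[] all-visited

theorem1p3 : ∀ {n m} (E : Hypergraph n m) (c k μ : ℕ) →
    Admissible E c k μ →
    (MinDegGE E 2 k
    ⊎ (MinDegGE E 3 1 × k * k + 5 ≤ n + 3 * k)
    ⊎ ∃ λ r → 4 ≤ r × r ≤ k × MinDegGE E r 1) →
    HasSpanningEulerTour E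
theorem1p3 {n} E c k μ ((c≤size , _) , 3≤c , (size≤ , e , ∣e∣≡k) , _ , above) hyp =
  minDeg₂⇒spanningTour E (λ i → ≤-trans 3≤c (c≤size i)) size≤ e (minDeg₂ hyp)
  where
  minDeg₂ : _ → MinDegGE E 2 k
  minDeg₂ (inj₁ δ₂)                               = δ₂
  minDeg₂ (inj₂ (inj₁ (δ₃ , big)))                = minDeg₃⇒minDeg₂ E (≤-trans 3≤c (≤-trans (c≤size e) (size≤ e))) size≤ big δ₃
  minDeg₂ (inj₂ (inj₂ (r , 4≤r , r≤k , δᵣ))) =
    minDeg₄⇒minDeg₂ E (≤-trans 4≤r r≤k) size≤ (aboveG⇒binomial {μ = μ} 3≤c (≤-trans 4≤r r≤k) above)
      (minDeg-down-to-4 E (r ∸ 4) size≤ (subst (_≤ n) (sym r≡) r≤n) (subst (λ t → MinDegGE E t 1) (sym r≡) δᵣ))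
    where
    r≡ : r ∸ 4 + 4 ≡ r
    r≡ = m∸n+n≡m 4≤r
    -- Some edge has exactly `k` vertices, so `k` is at most `n`.
    r≤n : r ≤ n
    r≤n = ≤-trans r≤k (≤-trans (≤-reflexive (sym ∣e∣≡k)) (∣p∣≤n (E e)))
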